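{- Let $M,N\in\mathbb{Z}^{r\times n}$ (where $0<r\le n$) be two full-rank weakly unimodular matrices with irredundant columns, and assume that the polytopes $\mathcal{P}_M$ and $\mathcal{P}_N$ are unimodularly equivalent. Then there exist $F\in\mathrm{GL}_r(\mathbb{Z})$ and a signed permutation matrix $P\in\mathbb{Z}^{n\times n}$ such that $N=FMP$. In particular, $N$ and $M$ represent the same simple regular matroid.
   Context: A matrix $M\in\mathbb{Z}^{r\times n}$ with $0<r\le n$ is full-rank weakly unimodular if it has rank $r$ and every $r\times r$ minor lies in $\{0,\pm1\}$. $M$ has irredundant columns if no column is zero and no two distinct columns $\mathbf{c}_i,\mathbf{c}_j$ satisfy $\mathbf{c}_i=\pm\mathbf{c}_j$ (equivalently, the matroid represented by $M$ on the column index set is simple). $\mathcal{P}_M\subseteq\mathbb{R}^r$ is the convex hull of the columns of $[M\mid -M]$. Two polytopes $P,Q\subseteq\mathbb{R}^r$ are unimodularly equivalent if $Q=F(P)+\mathbf{v}$ for some $F\in\mathrm{GL}_r(\mathbb{Z})$ and $\mathbf{v}\in\mathbb{Z}^r$. A signed permutation matrix is a permutation matrix with some entries $1$ replaced by $-1$. -}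

module Defs where

open import Data.Nat using (ℕ; zero; suc; _+_)
open import Data.Fin using (Fin; zero; suc; punchIn; splitAt; _<_; _≟_)
open import Data.Sum using (_⊎_; inj₁; inj₂; [_,_])
open import Data.Product using (Σ; ∃; _×_; _,_)
open import Data.Integer as ℤ using (ℤ; +_; -[1+_])
open import Data.Rational as ℚ using (ℚ; 0ℚ; 1ℚ)
open import Relation.Binary.PropositionalEquality using (_≡_; _≢_)
open import Relation.Nullary using (¬_; yes; no)
open import Function.Bundles using (_⇔_)
open import Data.Fin.Permutation using (Permutation′; _⟨$⟩ʳ_)

Matrix : ℕ → ℕ → Set
Matrix m n = Fin m → Fin n → ℤ

sumℤ : ∀ {n} → (Fin n → ℤ) → ℤ
sumℤ {zero}  f = + 0
sumℤ {suc n} f = f zero ℤ.+ sumℤ (λ i → f (suc i))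

sumℚ : ∀ {n} → (Fin n → ℚ) → ℚ
sumℚ {zero}  f = 0ℚ
sumℚ {suc n} f = f zero ℚ.+ sumℚ (λ i → f (suc i))

_⊗_ : ∀ {m k n} → Matrix m k → Matrix k n → Matrix m n
(A ⊗ B) i j = sumℤ (λ l → A i l ℤ.* B l j)

idMat : ∀ {n} → Matrix n n
idMat i j with i ≟ j
... | yes _ = + 1
... | no  _ = + 0

signFin : ∀ {n} → Fin n → ℤ
signFin zero    = + 1
signFin (suc j) = ℤ.- signFin j

det : ∀ {n} → Matrix n n → ℤ
det {zero}  A = + 1
det {suc n} A = sumℤ (λ j → signFin j ℤ.* (A zero j ℤ.* det (λ a b → A (suc a) (punchIn j b))))

StrictlyIncreasing : ∀ {r n} → (Fin r → Fin n) → Set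
StrictlyIncreasing c = ∀ i j → i < j → c i < c j

maxMinor : ∀ {r n} → Matrix r n → (Fin r → Fin n) → ℤ
maxMinor M c = det (λ i j → M i (c j))

-- rank M = r (full row rank), stated via the determinantal rank:
-- some r × r minor is nonzero.
FullRank : ∀ {r n} → Matrix r n → Set
FullRank {r} {n} M = Σ (Fin r → Fin n) λ c → StrictlyIncreasing c × maxMinor M c ≢ + 0

FullRankWeaklyUnimodular : ∀ {r n} → Matrix r n → Set
FullRankWeaklyUnimodular {r} {n} M =
  FullRank M ×
  (∀ (c : Fin r → Fin n) → StrictlyIncreasing c →
     (maxMinor M c ≡ + 0) ⊎ (maxMinor M c ≡ + 1) ⊎ (maxMinor M c ≡ -[1+ 0 ]))

IrredundantColumns : ∀ {r n} → Matrix r n → Set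
IrredundantColumns {r} {n} M =
  (∀ (j : Fin n) → ¬ (∀ i → M i j ≡ + 0)) ×
  (∀ (j k : Fin n) → j ≢ k →
     ¬ (∀ i → M i j ≡ M i k) × ¬ (∀ i → M i j ≡ ℤ.- M i k))

InGL : ∀ {r} → Matrix r r → Set
InGL {r} F = Σ (Matrix r r) λ G → (∀ i j → (F ⊗ G) i j ≡ idMat i j) × (∀ i j → (G ⊗ F) i j ≡ idMat i j)

SignedPermutationMatrix : ∀ {n} → Matrix n n → Set
SignedPermutationMatrix {n} P =
  Σ (Permutation′ n) λ σ → Σ (Fin n → ℤ) λ ε →
    (∀ i → (ε i ≡ + 1) ⊎ (ε i ≡ -[1+ 0 ])) ×
    (∀ i j → P i j ≡ helper σ ε i j)
  where
  helper : Permutation′ n → (Fin n → ℤ) → Fin n → Fin n → ℤ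
  helper σ ε i j with j ≟ (σ ⟨$⟩ʳ i)
  ... | yes _ = ε i
  ... | no  _ = + 0

-- Points of ℚ^r (rational points of ℝ^r).
Point : ℕ → Set
Point r = Fin r → ℚ

InConvexHull : ∀ {r k} → (Fin k → Point r) → Point r → Set
InConvexHull {r} {k} pts x =
  Σ (Fin k → ℚ) λ λs →
    (∀ a → 0ℚ ℚ.≤ λs a) × (sumℚ λs ≡ 1ℚ) ×
    (∀ i → x i ≡ sumℚ (λ a → λs a ℚ.* pts a i))

columnsPM : ∀ {r n} → Matrix r n → Fin (n + n) → Point r
columnsPM {r} {n} M a i = [ (λ j → M i j ℚ./ 1) , (λ j → (ℤ.- M i j) ℚ./ 1) ] (splitAt n a)

-- 𝒫_M = conv(columns of [M | -M]) (its rational points).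
𝒫 : ∀ {r n} → Matrix r n → Point r → Set
𝒫 M = InConvexHull (columnsPM M)

AffineImage : ∀ {r} → Matrix r r → (Fin r → ℤ) → (Point r → Set) → Point r → Set
AffineImage {r} F v P x =
  Σ (Point r) λ y → P y × (∀ i → x i ≡ sumℚ (λ j → (F i j ℚ./ 1) ℚ.* y j) ℚ.+ (v i ℚ./ 1))

UnimodularlyEquivalent : ∀ {r} → (Point r → Set) → (Point r → Set) → Set
UnimodularlyEquivalent {r} P Q =
  Σ (Matrix r r) λ F → Σ (Fin r → ℤ) λ v →
    InGL F × (∀ x → Q x ⇔ AffineImage F v P x)

{-# OPTIONS --safe #-}

-- Each column c of M is exposed by an integral functional: complete c to a basis of columns with
-- minor ±1. In the resulting coordinates f all columns have entries in {0, ±1}, and pivoting shows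
-- that, among the signed columns with f_p = 1 (p the position of c), every other coordinate f_i
-- takes values in {0, 1} or in {0, -1}. With signs t_i chosen accordingly, r f_p - Σ_{i ≠ p} t_i f_i
-- is maximal on 𝒫_M exactly at c.
-- Central symmetry of both polytopes makes 𝒫_M invariant under a translation by 2 F⁻¹ v, and an
-- exposed point forces v = 0. Then F c is an exposed point of 𝒫_N, hence a signed column of N.
-- Irredundancy makes the induced map on column indices injective, so it is a permutation.

module Submission where

open import Defs
open import Data.Nat using (ℕ; _<_; _≤_)
open import Data.Fin using (Fin)
open import Data.Product using (Σ; _×_)
open import Relation.Binary.PropositionalEquality using (_≡_)

open import Algebra.Structures using (IsCommutativeRing)
open import Data.Nat as ℕ using (zero; suc)
import Data.Nat.Properties as ℕP
open import Data.Fin as Fin using (zero; suc; punchIn; punchOut; inject₁; toℕ; _≟_; splitAt; join; _↑ˡ_; _↑ʳ_)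
open import Data.Fin.Permutation using (Permutation′; permutation; _⟨$⟩ʳ_)
open import Data.Fin.Properties using (all?; any?; ¬∀⟶∃¬; injective⇒≤; punchIn-injective; punchIn-punchOut; punchInᵢ≢i; punchOut-injective; splitAt-↑ˡ; splitAt-↑ʳ; toℕ-inject₁; toℕ-injective; <-cmp; <-trans)
open import Data.Integer as ℤ using (ℤ; +_; -[1+_]; _+_; _*_; -_; _-_; +≤+; -≤+; +<+)
import Data.Integer.Properties as ℤP
open import Data.Integer.Tactic.RingSolver using (solve-∀)
open import Data.Product using (∃; _,_; proj₁; proj₂)
open import Data.Rational as ℚ using (ℚ; 0ℚ; 1ℚ)
import Data.Rational.Properties as ℚP
open import Data.Rational.Solver using (module +-*-Solver)
import Data.Rational.Unnormalised as ℚᵘ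
import Data.Rational.Unnormalised.Properties as ℚᵘP
open import Data.Sum as Sum using (_⊎_; inj₁; inj₂; swap; [_,_])
open import Data.Vec using (Vec; []; _∷_; lookup; tabulate)
open import Data.Vec.Functional using (updateAt; insertAt)
open import Data.Vec.Functional.Properties using (updateAt-updates; updateAt-minimal; insertAt-lookup; insertAt-punchIn)
open import Data.Vec.Properties using (lookup∘tabulate)
open import Data.Vec.Relation.Unary.All as All using (All; []; _∷_)
open import Data.Vec.Relation.Unary.AllPairs using (AllPairs; []; _∷_)
open import Function using (_∘_; const; case_of_)
open import Function.Bundles using (_⇔_; module Equivalence)
open import Relation.Binary.Definitions using (tri<; tri≈; tri>)
open import Relation.Binary.PropositionalEquality using (_≢_; refl; sym; trans; cong; cong₂; subst; subst₂; module ≡-Reasoning)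
open import Relation.Binary.Structures using (IsPartialOrder)
open import Relation.Nullary using (yes; no; ¬_; contradiction)

-- Weak unimodularity constrains the minors of increasing column selections only, but exchanging one
-- basis column breaks the order and may repeat a column. The sign bounds therefore have to reach
-- arbitrary selections, and the determinant theory is built for that from two properties:
-- alternation and linearity in a single column. Exposed points carry the geometry because of one
-- fact about averages: if a convex combination attains the maximum of a functional, then so does
-- every generator of nonzero weight. It is used twice, once to exclude a translation and once to
-- locate `F c`: the generators of `𝒫 N` that represent `F c` are pulled back into `𝒫 M`, where the
-- functional exposing `c` forces those of nonzero weight to coincide with `c`. Exposedness itself
-- is a finite statement about integers, and averaging carries it to the rational points.

-- Finite sums over an ordered commutative ring

module FiniteSum
  {A : Set} {_⊕_ _⊛_ : A → A → A} {neg : A → A} {0# 1# : A} {_≤_ : A → A → Set}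
  (isCommutativeRing : IsCommutativeRing _≡_ _⊕_ _⊛_ neg 0# 1#)
  (isPartialOrder : IsPartialOrder _≡_ _≤_)
  (+-mono-≤ : ∀ {a b c d} → a ≤ b → c ≤ d → (a ⊕ c) ≤ (b ⊕ d))
  (∑ : ∀ {n} → (Fin n → A) → A)
  (∑-zero : (f : Fin 0 → A) → ∑ f ≡ 0#)
  (∑-suc : ∀ {n} (f : Fin (suc n) → A) → ∑ f ≡ f zero ⊕ ∑ (f ∘ suc))
  where

  open IsCommutativeRing isCommutativeRing
    using (+-assoc; +-comm; +-identityˡ; +-identityʳ; *-assoc; *-comm; distribˡ; zeroʳ)
  open IsPartialOrder isPartialOrder using (antisym) renaming (refl to ≤-refl; trans to ≤-trans; reflexive to ≤-reflexive)
  open ≡-Reasoning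

  +-interchange : ∀ a b c d → ((a ⊕ b) ⊕ (c ⊕ d)) ≡ ((a ⊕ c) ⊕ (b ⊕ d))
  +-interchange a b c d = begin
    (a ⊕ b) ⊕ (c ⊕ d)  ≡⟨ +-assoc a b (c ⊕ d) ⟩
    a ⊕ (b ⊕ (c ⊕ d))  ≡⟨ cong (a ⊕_) (sym (+-assoc b c d)) ⟩
    a ⊕ ((b ⊕ c) ⊕ d)  ≡⟨ cong (λ z → a ⊕ (z ⊕ d)) (+-comm b c) ⟩
    a ⊕ ((c ⊕ b) ⊕ d)  ≡⟨ cong (a ⊕_) (+-assoc c b d) ⟩
    a ⊕ (c ⊕ (b ⊕ d))  ≡⟨ sym (+-assoc a c (b ⊕ d)) ⟩
    (a ⊕ c) ⊕ (b ⊕ d)  ∎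

  ∑-cong : ∀ {n} {f g : Fin n → A} → (∀ i → f i ≡ g i) → ∑ f ≡ ∑ g
  ∑-cong {zero}  {f} {g} h = trans (∑-zero f) (sym (∑-zero g))
  ∑-cong {suc n} {f} {g} h =
    trans (∑-suc f) (trans (cong₂ _⊕_ (h zero) (∑-cong (h ∘ suc))) (sym (∑-suc g)))

  ∑-≡0 : ∀ {n} {f : Fin n → A} → (∀ i → f i ≡ 0#) → ∑ f ≡ 0#
  ∑-≡0 {zero}  {f} h = ∑-zero f
  ∑-≡0 {suc n} {f} h =
    trans (∑-suc f) (trans (cong₂ _⊕_ (h zero) (∑-≡0 (h ∘ suc))) (+-identityˡ 0#))

  ∑-+ : ∀ {n} (f g : Fin n → A) → ∑ (λ i → f i ⊕ g i) ≡ (∑ f ⊕ ∑ g)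
  ∑-+ {zero}  f g =
    trans (∑-zero _) (trans (sym (+-identityˡ 0#)) (sym (cong₂ _⊕_ (∑-zero f) (∑-zero g))))
  ∑-+ {suc n} f g = begin
    ∑ (λ i → f i ⊕ g i)                                        ≡⟨ ∑-suc _ ⟩
    (f zero ⊕ g zero) ⊕ ∑ (λ i → f (suc i) ⊕ g (suc i))        ≡⟨ cong ((f zero ⊕ g zero) ⊕_) (∑-+ (f ∘ suc) (g ∘ suc)) ⟩
    (f zero ⊕ g zero) ⊕ (∑ (f ∘ suc) ⊕ ∑ (g ∘ suc))            ≡⟨ +-interchange _ _ _ _ ⟩
    (f zero ⊕ ∑ (f ∘ suc)) ⊕ (g zero ⊕ ∑ (g ∘ suc))            ≡⟨ sym (cong₂ _⊕_ (∑-suc f) (∑-suc g)) ⟩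
    ∑ f ⊕ ∑ g                                                  ∎

  ∑-*ˡ : ∀ {n} c (f : Fin n → A) → ∑ (λ i → c ⊛ f i) ≡ (c ⊛ ∑ f)
  ∑-*ˡ {zero}  c f = trans (∑-zero _) (sym (trans (cong (c ⊛_) (∑-zero f)) (zeroʳ c)))
  ∑-*ˡ {suc n} c f = begin
    ∑ (λ i → c ⊛ f i)                          ≡⟨ ∑-suc _ ⟩
    (c ⊛ f zero) ⊕ ∑ (λ i → c ⊛ f (suc i))     ≡⟨ cong ((c ⊛ f zero) ⊕_) (∑-*ˡ c (f ∘ suc)) ⟩
    (c ⊛ f zero) ⊕ (c ⊛ ∑ (f ∘ suc))           ≡⟨ sym (distribˡ c _ _) ⟩
    c ⊛ (f zero ⊕ ∑ (f ∘ suc))                 ≡⟨ cong (c ⊛_) (sym (∑-suc f)) ⟩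
    c ⊛ ∑ f                                    ∎

  ∑-*ʳ : ∀ {n} c (f : Fin n → A) → ∑ (λ i → f i ⊛ c) ≡ (∑ f ⊛ c)
  ∑-*ʳ c f = trans (∑-cong (λ i → *-comm (f i) c)) (trans (∑-*ˡ c f) (*-comm c _))

  ∑-swap : ∀ {m n} (f : Fin m → Fin n → A) → ∑ (λ i → ∑ (f i)) ≡ ∑ (λ j → ∑ (λ i → f i j))
  ∑-swap {zero}  f = trans (∑-zero _) (sym (∑-≡0 (λ j → ∑-zero _)))
  ∑-swap {suc m} f = begin
    ∑ (λ i → ∑ (f i))                                       ≡⟨ ∑-suc _ ⟩
    ∑ (f zero) ⊕ ∑ (λ i → ∑ (f (suc i)))                    ≡⟨ cong (∑ (f zero) ⊕_) (∑-swap (f ∘ suc)) ⟩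
    ∑ (f zero) ⊕ ∑ (λ j → ∑ (λ i → f (suc i) j))            ≡⟨ sym (∑-+ _ _) ⟩
    ∑ (λ j → f zero j ⊕ ∑ (λ i → f (suc i) j))              ≡⟨ ∑-cong (λ j → sym (∑-suc _)) ⟩
    ∑ (λ j → ∑ (λ i → f i j))                               ∎

  ∑-assoc : ∀ {m n} (a : Fin m → A) (B : Fin m → Fin n → A) (x : Fin n → A) →
    ∑ (λ i → a i ⊛ ∑ (λ j → B i j ⊛ x j)) ≡ ∑ (λ j → ∑ (λ i → a i ⊛ B i j) ⊛ x j)
  ∑-assoc a B x = begin
    ∑ (λ i → a i ⊛ ∑ (λ j → B i j ⊛ x j))      ≡⟨ ∑-cong (λ i → sym (∑-*ˡ (a i) _)) ⟩
    ∑ (λ i → ∑ (λ j → a i ⊛ (B i j ⊛ x j)))    ≡⟨ ∑-swap _ ⟩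
    ∑ (λ j → ∑ (λ i → a i ⊛ (B i j ⊛ x j)))    ≡⟨ ∑-cong (λ j → ∑-cong (λ i → sym (*-assoc (a i) (B i j) (x j)))) ⟩
    ∑ (λ j → ∑ (λ i → (a i ⊛ B i j) ⊛ x j))    ≡⟨ ∑-cong (λ j → ∑-*ʳ (x j) _) ⟩
    ∑ (λ j → ∑ (λ i → a i ⊛ B i j) ⊛ x j)      ∎

  ∑-remove : ∀ {n} (p : Fin (suc n)) (f : Fin (suc n) → A) → ∑ f ≡ (f p ⊕ ∑ (f ∘ punchIn p))
  ∑-remove zero f = ∑-suc f
  ∑-remove {suc n} (suc p) f = begin
    ∑ f                                                     ≡⟨ ∑-suc f ⟩
    f zero ⊕ ∑ (f ∘ suc)                                    ≡⟨ cong (f zero ⊕_) (∑-remove p (f ∘ suc)) ⟩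
    f zero ⊕ (f (suc p) ⊕ ∑ (f ∘ suc ∘ punchIn p))          ≡⟨ sym (+-assoc _ _ _) ⟩
    (f zero ⊕ f (suc p)) ⊕ ∑ (f ∘ suc ∘ punchIn p)          ≡⟨ cong (_⊕ _) (+-comm _ _) ⟩
    (f (suc p) ⊕ f zero) ⊕ ∑ (f ∘ suc ∘ punchIn p)          ≡⟨ +-assoc _ _ _ ⟩
    f (suc p) ⊕ (f zero ⊕ ∑ (f ∘ suc ∘ punchIn p))          ≡⟨ cong (f (suc p) ⊕_) (sym (∑-suc _)) ⟩
    f (suc p) ⊕ ∑ (f ∘ punchIn (suc p))                     ∎

  ∑-single : ∀ {n} (p : Fin n) (f : Fin n → A) → (∀ i → i ≢ p → f i ≡ 0#) → ∑ f ≡ f p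
  ∑-single {suc n} p f h =
    trans (∑-remove p f) (trans (cong (f p ⊕_) (∑-≡0 (λ i → h _ (punchInᵢ≢i p i)))) (+-identityʳ _))

  ∑-nonneg : ∀ {n} {f : Fin n → A} → (∀ i → 0# ≤ f i) → 0# ≤ ∑ f
  ∑-nonneg {zero}  {f} h = ≤-reflexive (sym (∑-zero f))
  ∑-nonneg {suc n} {f} h =
    ≤-trans (≤-reflexive (sym (+-identityˡ 0#)))
      (≤-trans (+-mono-≤ (h zero) (∑-nonneg (h ∘ suc))) (≤-reflexive (sym (∑-suc f))))

  term≤∑ : ∀ {n} {f : Fin n → A} → (∀ i → 0# ≤ f i) → ∀ p → f p ≤ ∑ f
  term≤∑ {suc n} {f} h p =
    ≤-trans (≤-reflexive (sym (+-identityʳ _)))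
      (≤-trans (+-mono-≤ ≤-refl (∑-nonneg (h ∘ punchIn p))) (≤-reflexive (sym (∑-remove p f))))

  ∑-nonneg-≡0 : ∀ {n} {f : Fin n → A} → (∀ i → 0# ≤ f i) → ∑ f ≡ 0# → ∀ p → f p ≡ 0#
  ∑-nonneg-≡0 h e p = antisym (≤-trans (term≤∑ h p) (≤-reflexive e)) (h p)

-- The two sums are separate recursions, so the module takes the sum itself as a parameter; both
-- recursion equations hold definitionally.
module ℤΣ = FiniteSum ℤP.+-*-isCommutativeRing ℤP.≤-isPartialOrder ℤP.+-mono-≤ sumℤ (λ _ → refl) (λ _ → refl)
module ℚΣ = FiniteSum ℚP.+-*-isCommutativeRing ℚP.≤-isPartialOrder ℚP.+-mono-≤ sumℚ (λ _ → refl) (λ _ → refl)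

-- Determinants

det-cong : ∀ {n} {A B : Matrix n n} → (∀ i j → A i j ≡ B i j) → det A ≡ det B
det-cong {zero}  h = refl
det-cong {suc n} h =
  ℤΣ.∑-cong (λ j → cong (signFin j *_) (cong₂ _*_ (h zero j) (det-cong (λ a b → h (suc a) (punchIn j b)))))

-- Recursion on the position, rather than a test for equality of indices, lets the swap compute in
-- step with `punchIn` and `signFin`.
adjacentSwap : ∀ {m} → Fin m → Fin (suc m) → Fin (suc m)
adjacentSwap zero    zero          = suc zero
adjacentSwap zero    (suc zero)    = zero
adjacentSwap zero    (suc (suc x)) = suc (suc x)
adjacentSwap (suc p) zero          = zero
adjacentSwap (suc p) (suc x)       = suc (adjacentSwap p x)

adjacentSwap-inject₁ : ∀ {m} (p : Fin m) → adjacentSwap p (inject₁ p) ≡ suc p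
adjacentSwap-inject₁ zero    = refl
adjacentSwap-inject₁ (suc p) = cong suc (adjacentSwap-inject₁ p)

adjacentSwap-suc : ∀ {m} (p : Fin m) → adjacentSwap p (suc p) ≡ inject₁ p
adjacentSwap-suc zero    = refl
adjacentSwap-suc (suc p) = cong suc (adjacentSwap-suc p)

adjacentSwap-fixes : ∀ {m} (p : Fin m) j → j ≢ inject₁ p → j ≢ suc p → adjacentSwap p j ≡ j
adjacentSwap-fixes zero    zero          h k = contradiction refl h
adjacentSwap-fixes zero    (suc zero)    h k = contradiction refl k
adjacentSwap-fixes zero    (suc (suc j)) h k = refl
adjacentSwap-fixes (suc p) zero          h k = refl
adjacentSwap-fixes (suc p) (suc j)       h k =
  cong suc (adjacentSwap-fixes p j (h ∘ cong suc) (k ∘ cong suc))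

∑-adjacentSwap : ∀ {m} (p : Fin m) (f : Fin (suc m) → ℤ) → sumℤ (f ∘ adjacentSwap p) ≡ sumℤ f
∑-adjacentSwap zero f = swap₂ (f zero) (f (suc zero)) _
  where
  swap₂ : ∀ a b c → b + (a + c) ≡ a + (b + c)
  swap₂ = solve-∀
∑-adjacentSwap (suc p) f = cong (λ z → f zero + z) (∑-adjacentSwap p (f ∘ suc))

-- Deleting column j after an adjacent swap: either j is one of the two swapped
-- columns, or the swap induces an adjacent swap of the remaining columns.
data SwapMinor : ∀ {m} (p : Fin m) (j : Fin (suc m)) → Set where
  moved : ∀ {m} {p : Fin m} {j} → signFin (adjacentSwap p j) ≡ - signFin j →
          (∀ b → adjacentSwap p (punchIn j b) ≡ punchIn (adjacentSwap p j) b) → SwapMinor p j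
  fixed : ∀ {m} {p : Fin (suc m)} {j} (p′ : Fin m) → adjacentSwap p j ≡ j →
          (∀ b → adjacentSwap p (punchIn j b) ≡ punchIn j (adjacentSwap p′ b)) → SwapMinor p j

swapMinor : ∀ {m} (p : Fin m) (j : Fin (suc m)) → SwapMinor p j
swapMinor zero zero          = moved refl λ { zero → refl ; (suc b) → refl }
swapMinor zero (suc zero)    = moved refl λ { zero → refl ; (suc b) → refl }
swapMinor {suc (suc m)} zero (suc (suc j)) =
  fixed zero refl λ { zero → refl ; (suc zero) → refl ; (suc (suc b)) → refl }
swapMinor {suc (suc m)} (suc p) zero = fixed p refl λ b → refl
swapMinor {suc zero} (suc ()) zero
swapMinor (suc p) (suc j) with swapMinor p j
... | moved s h    = moved (cong -_ s) λ { zero → refl ; (suc b) → cong suc (h b) }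
... | fixed p′ e h = fixed (suc p′) (cong suc e) λ { zero → refl ; (suc b) → cong suc (h b) }

-- Every term of the first-row expansion changes sign: for a swapped column the cofactor sign flips
-- and the minor stays, for any other column the sign stays and the minor undergoes an adjacent
-- swap, so induction applies. The swap then only reindexes the sum.
det-adjacentSwap : ∀ {m} (p : Fin m) (A : Matrix (suc m) (suc m)) →
  det (λ i j → A i (adjacentSwap p j)) ≡ - det A
det-adjacentSwap {m} p A = begin
  sumℤ (term (λ i j → A i (adjacentSwap p j)))    ≡⟨ ℤΣ.∑-cong swapped ⟩
  sumℤ (λ j → -[1+ 0 ] * term A (adjacentSwap p j)) ≡⟨ ℤΣ.∑-*ˡ -[1+ 0 ] (term A ∘ adjacentSwap p) ⟩
  -[1+ 0 ] * sumℤ (term A ∘ adjacentSwap p)         ≡⟨ cong (-[1+ 0 ] *_) (∑-adjacentSwap p (term A)) ⟩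
  -[1+ 0 ] * sumℤ (term A)                          ≡⟨ ℤP.-1*i≡-i _ ⟩
  - det A                                         ∎
  where
  open ≡-Reasoning
  term : Matrix (suc m) (suc m) → Fin (suc m) → ℤ
  term B j = signFin j * (B zero j * det (λ a b → B (suc a) (punchIn j b)))
  neg-sign : ∀ s x y → s * (x * y) ≡ -[1+ 0 ] * (- s * (x * y))
  neg-sign = solve-∀
  neg-minor : ∀ s x y → s * (x * (- y)) ≡ -[1+ 0 ] * (s * (x * y))
  neg-minor = solve-∀
  swapped : ∀ j → term (λ i j → A i (adjacentSwap p j)) j ≡ -[1+ 0 ] * term A (adjacentSwap p j)
  swapped j with swapMinor p j
  ... | moved s h = begin
    signFin j * (A zero (adjacentSwap p j) * det (λ a b → A (suc a) (adjacentSwap p (punchIn j b))))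
      ≡⟨ neg-sign (signFin j) (A zero (adjacentSwap p j)) (det (λ a b → A (suc a) (adjacentSwap p (punchIn j b)))) ⟩
    -[1+ 0 ] * (- signFin j * (A zero (adjacentSwap p j) * det (λ a b → A (suc a) (adjacentSwap p (punchIn j b)))))
      ≡⟨ cong (-[1+ 0 ] *_) (cong₂ _*_ (sym s) (cong (A zero (adjacentSwap p j) *_)
           (det-cong (λ a b → cong (A (suc a)) (h b))))) ⟩
    -[1+ 0 ] * term A (adjacentSwap p j) ∎
  ... | fixed p′ e h = begin
    signFin j * (A zero (adjacentSwap p j) * det (λ a b → A (suc a) (adjacentSwap p (punchIn j b))))
      ≡⟨ cong (λ d → signFin j * (A zero (adjacentSwap p j) * d)) (trans
           (det-cong (λ a b → cong (A (suc a)) (h b)))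
           (det-adjacentSwap p′ (λ a b → A (suc a) (punchIn j b)))) ⟩
    signFin j * (A zero (adjacentSwap p j) * (- det (λ a b → A (suc a) (punchIn j b))))
      ≡⟨ neg-minor (signFin j) (A zero (adjacentSwap p j)) (det (λ a b → A (suc a) (punchIn j b))) ⟩
    -[1+ 0 ] * (signFin j * (A zero (adjacentSwap p j) * det (λ a b → A (suc a) (punchIn j b))))
      ≡⟨ cong (λ k → -[1+ 0 ] * (signFin j * (A zero k * det (λ a b → A (suc a) (punchIn j b))))) e ⟩
    -[1+ 0 ] * term A j
      ≡⟨ cong (λ k → -[1+ 0 ] * term A k) (sym e) ⟩
    -[1+ 0 ] * term A (adjacentSwap p j) ∎

i≡-i⇒i≡0 : ∀ i → i ≡ - i → i ≡ + 0
i≡-i⇒i≡0 (+ zero)   e = refl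

det-adjacentSwap-invariant : ∀ {m} (p : Fin m) (A : Matrix (suc m) (suc m)) →
  (∀ a j → A a (adjacentSwap p j) ≡ A a j) → det A ≡ + 0
det-adjacentSwap-invariant p A h =
  i≡-i⇒i≡0 (det A) (trans (sym (det-cong h)) (det-adjacentSwap p A))

-- Moving the right-hand copy leftwards makes the two equal columns adjacent.
det-equalColumns-< : ∀ {n} d (A : Matrix n n) i k → toℕ k ≡ d → i Fin.< k → (∀ a → A a i ≡ A a k) → det A ≡ + 0
det-equalColumns-< {suc n} (suc d) A i (suc k) ek i<k h with i ≟ inject₁ k
... | yes refl = det-adjacentSwap-invariant k A same
  where
  same : ∀ a j → A a (adjacentSwap k j) ≡ A a j
  same a j with j ≟ inject₁ k | j ≟ suc k
  ... | yes refl | _        = trans (cong (A a) (adjacentSwap-inject₁ k)) (sym (h a))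
  ... | no _     | yes refl = trans (cong (A a) (adjacentSwap-suc k)) (h a)
  ... | no u     | no v     = cong (A a) (adjacentSwap-fixes k j u v)
... | no i≢ = ℤP.neg-injective (trans (sym (det-adjacentSwap k A))
    (det-equalColumns-< d (λ a j → A a (adjacentSwap k j)) i (inject₁ k)
      (trans (toℕ-inject₁ k) (ℕP.suc-injective ek))
      (subst (toℕ i ℕ.<_) (sym (toℕ-inject₁ k))
        (ℕP.≤∧≢⇒< (ℕP.≤-pred i<k) (λ e → i≢ (toℕ-injective (trans e (sym (toℕ-inject₁ k)))))))
      (λ a → trans (cong (A a) (adjacentSwap-fixes k i i≢ λ { refl → ℕP.<-irrefl refl i<k }))
               (trans (h a) (cong (A a) (sym (adjacentSwap-inject₁ k)))))))

det-equalColumns : ∀ {n} (A : Matrix n n) i k → i ≢ k → (∀ a → A a i ≡ A a k) → det A ≡ + 0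
det-equalColumns A i k i≢k h with <-cmp i k
... | tri< i<k _ _ = det-equalColumns-< _ A i k refl i<k h
... | tri≈ _ e _   = contradiction e i≢k
... | tri> _ _ k<i = det-equalColumns-< _ A k i refl k<i (sym ∘ h)

-- The vector `g` consists of the cofactors of column `p`, which depend only on the other columns.
-- It is chosen before `A′`, so that one row of cofactors evaluates the determinant for every
-- replacement of column `p`; Cramer's rule rests on this order of quantifiers. In the first-row
-- expansion, the term `j = p` contributes only to `g zero`, and every other term recurses into its
-- minor.
det-linear : ∀ {n} (A : Matrix n n) (p : Fin n) →
  Σ (Fin n → ℤ) λ g → ∀ A′ → (∀ i j → j ≢ p → A′ i j ≡ A i j) → det A′ ≡ sumℤ (λ k → g k * A′ k p)
det-linear {suc m} A p = (λ k → sumℤ (λ j → proj₁ (functional j) k)) , λ A′ h → begin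
  sumℤ (term A′)                                                     ≡⟨ ℤΣ.∑-cong (λ j → proj₂ (functional j) A′ h) ⟩
  sumℤ (λ j → sumℤ (λ k → proj₁ (functional j) k * A′ k p))          ≡⟨ ℤΣ.∑-swap (λ j k → proj₁ (functional j) k * A′ k p) ⟩
  sumℤ (λ k → sumℤ (λ j → proj₁ (functional j) k * A′ k p))          ≡⟨ ℤΣ.∑-cong (λ k → ℤΣ.∑-*ʳ (A′ k p) (λ j → proj₁ (functional j) k)) ⟩
  sumℤ (λ k → sumℤ (λ j → proj₁ (functional j) k) * A′ k p)          ∎
  where
  open ≡-Reasoning
  term : Matrix (suc m) (suc m) → Fin (suc m) → ℤ
  term B j = signFin j * (B zero j * det (λ a b → B (suc a) (punchIn j b)))
  functional : ∀ j → Σ (Fin (suc m) → ℤ) λ g →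
    ∀ A′ → (∀ i j → j ≢ p → A′ i j ≡ A i j) → term A′ j ≡ sumℤ (λ k → g k * A′ k p)
  functional j with j ≟ p
  ... | yes refl = g , λ A′ h → begin
      signFin p * (A′ zero p * det (λ a b → A′ (suc a) (punchIn p b)))
        ≡⟨ cong (λ d → signFin p * (A′ zero p * d)) (det-cong (λ a b → h (suc a) (punchIn p b) (punchInᵢ≢i p b))) ⟩
      signFin p * (A′ zero p * minor)   ≡⟨ rearrange (signFin p) (A′ zero p) minor ⟩
      g zero * A′ zero p                ≡⟨ ℤΣ.∑-single zero (λ k → g k * A′ k p) (λ { zero z≢z → contradiction refl z≢z ; (suc k) _ → refl }) ⟨
      sumℤ (λ k → g k * A′ k p)         ∎
    where
    minor : ℤ
    minor = det (λ a b → A (suc a) (punchIn p b))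
    g : Fin (suc m) → ℤ
    g zero    = signFin p * minor
    g (suc k) = + 0
    rearrange : ∀ s x y → s * (x * y) ≡ (s * y) * x
    rearrange = solve-∀
  ... | no j≢p = g , λ A′ h → begin
      signFin j * (A′ zero j * det (λ a b → A′ (suc a) (punchIn j b)))
        ≡⟨ cong₂ (λ x d → signFin j * (x * d)) (h zero j j≢p)
             (trans (proj₂ rec (λ a b → A′ (suc a) (punchIn j b)) λ a b b≢ →
                       h (suc a) (punchIn j b) (λ e → b≢ (punchIn-injective j b p′ (trans e (sym (punchIn-punchOut j≢p))))))
                    (ℤΣ.∑-cong (λ k → cong (λ q → proj₁ rec k * A′ (suc k) q) (punchIn-punchOut j≢p)))) ⟩
      signFin j * (A zero j * sumℤ (λ k → proj₁ rec k * A′ (suc k) p))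
        ≡⟨ sym (ℤP.*-assoc (signFin j) (A zero j) _) ⟩
      (signFin j * A zero j) * sumℤ (λ k → proj₁ rec k * A′ (suc k) p)
        ≡⟨ sym (ℤΣ.∑-*ˡ (signFin j * A zero j) (λ k → proj₁ rec k * A′ (suc k) p)) ⟩
      sumℤ (λ k → (signFin j * A zero j) * (proj₁ rec k * A′ (suc k) p))
        ≡⟨ ℤΣ.∑-cong (λ k → sym (ℤP.*-assoc (signFin j * A zero j) (proj₁ rec k) (A′ (suc k) p))) ⟩
      sumℤ (λ k → g (suc k) * A′ (suc k) p)
        ≡⟨ sym (ℤP.+-identityˡ _) ⟩
      sumℤ (λ k → g k * A′ k p)         ∎
    where
    p′ : Fin m
    p′ = punchOut j≢p
    rec : Σ (Fin m → ℤ) _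
    rec = det-linear (λ a b → A (suc a) (punchIn j b)) p′
    g : Fin (suc m) → ℤ
    g zero    = + 0
    g (suc k) = (signFin j * A zero j) * proj₁ rec k

-- Minors of arbitrary column selections

data Swap {A : Set} : ∀ {n} → Vec A n → Vec A n → Set where
  here  : ∀ {n x y} {v : Vec A n} → Swap (x ∷ y ∷ v) (y ∷ x ∷ v)
  there : ∀ {n x} {v w : Vec A n} → Swap v w → Swap (x ∷ v) (x ∷ w)

swap-position : ∀ {A : Set} {m} {v w : Vec A (suc m)} → Swap v w →
  Σ (Fin m) λ p → ∀ j → lookup v (adjacentSwap p j) ≡ lookup w j
swap-position here = zero , λ { zero → refl ; (suc zero) → refl ; (suc (suc j)) → refl }
swap-position {m = suc m} (there s) with swap-position s
... | p , h = suc p , λ { zero → refl ; (suc j) → h j }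

Sorted : ∀ {n r} → Vec (Fin n) r → Set
Sorted = AllPairs Fin._<_

-- Insertion sort as an induction principle. `Swap w w` encodes a repeated adjacent entry. The
-- sorted case also receives that lower bounds of `x ∷ v` are lower bounds of `w`: after `y` has
-- been moved to the front, this is what keeps `y ∷ w` sorted.
insert-induction : ∀ {n r} (Q : Vec (Fin n) (suc r) → Set) x (v : Vec (Fin n) r) → Sorted v →
  (∀ w → Sorted w → (∀ (y : Fin n) → All (y Fin.<_) (x ∷ v) → All (y Fin.<_) w) → Q w) →
  (∀ {w} → Swap w w → Q w) →
  (∀ {w w′} → Swap w w′ → Q w′ → Q w) →
  Q (x ∷ v)
insert-induction Q x [] _ sorted repeated swapped = sorted (x ∷ []) ([] ∷ []) (λ _ a → a)
insert-induction Q x (y ∷ v) (y<v ∷ sv) sorted repeated swapped with <-cmp x y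
... | tri< x<y _ _ = sorted (x ∷ y ∷ v) ((x<y ∷ All.map (<-trans x<y) y<v) ∷ y<v ∷ sv) (λ _ a → a)
... | tri≈ _ refl _ = repeated here
... | tri> _ _ y<x = swapped here (insert-induction (Q ∘ (y ∷_)) x v sv
        (λ w sw low → sorted (y ∷ w) (low y (y<x ∷ y<v) ∷ sw) (λ { z (z<x ∷ z<y ∷ z<v) → z<y ∷ low z (z<x ∷ z<v) }))
        (repeated ∘ there) (swapped ∘ there))

sort-induction : ∀ {n r} (Q : Vec (Fin n) r → Set) →
  (∀ {w} → Sorted w → Q w) → (∀ {w} → Swap w w → Q w) → (∀ {w w′} → Swap w w′ → Q w′ → Q w) →
  ∀ v → Q v
sort-induction Q sorted repeated swapped [] = sorted []
sort-induction Q sorted repeated swapped (x ∷ v) =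
  sort-induction (Q ∘ (x ∷_))
    (λ {w} sw → insert-induction Q x w sw (λ _ s _ → sorted s) repeated swapped)
    (repeated ∘ there) (swapped ∘ there) v

lookup-All : ∀ {A : Set} {P : A → Set} {n} {v : Vec A n} → All P v → ∀ i → P (lookup v i)
lookup-All (px ∷ _)   zero    = px
lookup-All (_  ∷ pxs) (suc i) = lookup-All pxs i

lookup-increasing : ∀ {n r} {v : Vec (Fin n) r} → Sorted v → StrictlyIncreasing (lookup v)
lookup-increasing (x<v ∷ _) zero    (suc j) _   = lookup-All x<v j
lookup-increasing (_ ∷ sv)  (suc i) (suc j) i<j = lookup-increasing sv i j (ℕP.≤-pred i<j)

Trit : ℤ → Set
Trit z = (z ≡ + 0) ⊎ (z ≡ + 1) ⊎ (z ≡ -[1+ 0 ])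

Trit-neg : ∀ {z} → Trit (- z) → Trit z
Trit-neg {z} (inj₁ e)        = inj₁ (ℤP.neg-injective e)
Trit-neg {z} (inj₂ (inj₁ e)) = inj₂ (inj₂ (ℤP.neg-injective e))
Trit-neg {z} (inj₂ (inj₂ e)) = inj₂ (inj₁ (ℤP.neg-injective e))

maxMinor-cong : ∀ {r n} (M : Matrix r n) {c c′ : Fin r → Fin n} → (∀ j → c j ≡ c′ j) → maxMinor M c ≡ maxMinor M c′
maxMinor-cong M h = det-cong (λ i j → cong (M i) (h j))

maxMinor-swap : ∀ {r n} (M : Matrix r n) {v w : Vec (Fin n) r} → Swap v w →
  maxMinor M (lookup w) ≡ - maxMinor M (lookup v)
maxMinor-swap {suc r} M {v} s with swap-position s
... | p , h = trans (maxMinor-cong M (sym ∘ h)) (det-adjacentSwap p (λ i j → M i (lookup v j)))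

-- A swap of adjacent columns negates the minor and a repeated column makes it zero; the set of the
-- values 0, 1 and -1 is closed under both, so the bound spreads from increasing selections to all.
allMinors-Trit : ∀ {r n} (M : Matrix r n) → FullRankWeaklyUnimodular M → ∀ c → Trit (maxMinor M c)
allMinors-Trit M (_ , unimodular) c =
  subst Trit (maxMinor-cong M (lookup∘tabulate c))
    (sort-induction (λ v → Trit (maxMinor M (lookup v)))
      (λ {w} s → unimodular (lookup w) (lookup-increasing s))
      (λ {w} s → inj₁ (i≡-i⇒i≡0 _ (maxMinor-swap M s)))
      (λ {v} s t → Trit-neg (subst Trit (maxMinor-swap M s) t))
      (tabulate c))

-- Unimodular bases

idMat-diag : ∀ {n} (i : Fin n) → idMat i i ≡ + 1
idMat-diag i with i ≟ i
... | yes _  = refl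
... | no i≢i = contradiction refl i≢i

idMat-off : ∀ {n} {i j : Fin n} → i ≢ j → idMat i j ≡ + 0
idMat-off {i = i} {j} i≢j with i ≟ j
... | yes e = contradiction e i≢j
... | no _  = refl

∑-idMat : ∀ {n} (i : Fin n) (x : Fin n → ℤ) → sumℤ (λ k → idMat i k * x k) ≡ x i
∑-idMat i x = trans
  (ℤΣ.∑-single i (λ k → idMat i k * x k) (λ k k≢i → cong (_* x k) (idMat-off (k≢i ∘ sym))))
  (trans (cong (_* x i) (idMat-diag i)) (ℤP.*-identityˡ (x i)))

*-nonzero : ∀ {i j} → i ≢ + 0 → j ≢ + 0 → i * j ≢ + 0
*-nonzero {i} i≢0 j≢0 e with ℤP.i*j≡0⇒i≡0∨j≡0 i e
... | inj₁ z = i≢0 z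
... | inj₂ z = j≢0 z

-- Gaussian elimination without fractions. A zero first row is dropped together with a column, whose
-- coefficient becomes 0. Otherwise a nonzero entry `a` of that row is the pivot, the other rows are
-- cross-multiplied to clear its column, and a solution `y` of the smaller system lifts to `a * y`,
-- with the coefficient at `p` chosen to satisfy the first row.
kernel-vector : ∀ r (A : Matrix r (suc r)) →
  Σ (Fin (suc r) → ℤ) λ y → (∃ λ k → y k ≢ + 0) × (∀ i → sumℤ (λ k → A i k * y k) ≡ + 0)
kernel-vector zero A = (λ _ → + 1) , (zero , λ ()) , λ ()
kernel-vector (suc r) A with all? (λ k → A zero k ℤP.≟ + 0)
... | yes row≡0 with kernel-vector r (λ i k → A (suc i) (suc k))
...   | y , (k , yk≢0) , h = y′ , (suc k , yk≢0) , λ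
          { zero    → ℤΣ.∑-≡0 (λ k → cong (_* y′ k) (row≡0 k))
          ; (suc i) → trans (cong (_+ sumℤ (λ k → A (suc i) (suc k) * y k)) (ℤP.*-zeroʳ (A (suc i) zero)))
                        (trans (ℤP.+-identityˡ _) (h i)) }
  where
  y′ : Fin (suc (suc r)) → ℤ
  y′ zero    = + 0
  y′ (suc k) = y k
kernel-vector (suc r) A | no row≢0 with ¬∀⟶∃¬ _ _ (λ k → A zero k ℤP.≟ + 0) row≢0
... | p , a≢0 with kernel-vector r (λ i j → A zero p * A (suc i) (punchIn p j) - A (suc i) p * A zero (punchIn p j))
...   | y , (k , yk≢0) , h =
        y′ , (punchIn p k , λ e → *-nonzero a≢0 yk≢0 (trans (sym (insertAt-punchIn (λ j → a * y j) p (- s) k)) e)) , λ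
          { zero → begin
              sumℤ (λ k → A zero k * y′ k)                                   ≡⟨ split zero ⟩
              A zero p * (- s) + a * s                                       ≡⟨ cancel a s ⟩
              + 0                                                            ∎
          ; (suc i) → begin
              sumℤ (λ k → A (suc i) k * y′ k)                                ≡⟨ split (suc i) ⟩
              A (suc i) p * (- s) + a * t i                                  ≡⟨ rearrange (A (suc i) p) a s (t i) ⟩
              a * t i + (- A (suc i) p) * s                                  ≡⟨ sym (cong₂ _+_
                  (ℤΣ.∑-*ˡ a (λ j → A (suc i) (punchIn p j) * y j))
                  (ℤΣ.∑-*ˡ (- A (suc i) p) (λ j → A zero (punchIn p j) * y j))) ⟩
              sumℤ (λ j → a * (A (suc i) (punchIn p j) * y j)) + sumℤ (λ j → (- A (suc i) p) * (A zero (punchIn p j) * y j))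
                ≡⟨ sym (ℤΣ.∑-+ (λ j → a * (A (suc i) (punchIn p j) * y j)) (λ j → (- A (suc i) p) * (A zero (punchIn p j) * y j))) ⟩
              sumℤ (λ j → a * (A (suc i) (punchIn p j) * y j) + (- A (suc i) p) * (A zero (punchIn p j) * y j))
                ≡⟨ ℤΣ.∑-cong (λ j → factor a (A (suc i) (punchIn p j)) (A (suc i) p) (A zero (punchIn p j)) (y j)) ⟩
              sumℤ (λ j → (a * A (suc i) (punchIn p j) - A (suc i) p * A zero (punchIn p j)) * y j)
                ≡⟨ h i ⟩
              + 0 ∎ }
  where
  open ≡-Reasoning
  a s : ℤ
  a = A zero p
  s = sumℤ (λ j → A zero (punchIn p j) * y j)
  t : Fin r → ℤ
  t i = sumℤ (λ j → A (suc i) (punchIn p j) * y j)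
  y′ : Fin (suc (suc r)) → ℤ
  y′ = insertAt (λ j → a * y j) p (- s)
  cancel : ∀ a s → a * (- s) + a * s ≡ + 0
  cancel = solve-∀
  rearrange : ∀ b a s t → b * (- s) + a * t ≡ a * t + (- b) * s
  rearrange = solve-∀
  factor : ∀ a x b z y → a * (x * y) + (- b) * (z * y) ≡ (a * x - b * z) * y
  factor = solve-∀
  comm : ∀ b a y → b * (a * y) ≡ a * (b * y)
  comm = solve-∀
  split : ∀ i → sumℤ (λ k → A i k * y′ k) ≡ A i p * (- s) + a * sumℤ (λ j → A i (punchIn p j) * y j)
  split i = begin
    sumℤ (λ k → A i k * y′ k)
      ≡⟨ ℤΣ.∑-remove p (λ k → A i k * y′ k) ⟩
    A i p * y′ p + sumℤ (λ j → A i (punchIn p j) * y′ (punchIn p j))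
      ≡⟨ cong₂ _+_ (cong (A i p *_) (insertAt-lookup (λ j → a * y j) p (- s)))
           (ℤΣ.∑-cong (λ j → trans (cong (A i (punchIn p j) *_) (insertAt-punchIn (λ j → a * y j) p (- s) j))
                                   (comm (A i (punchIn p j)) a (y j)))) ⟩
    A i p * (- s) + sumℤ (λ j → a * (A i (punchIn p j) * y j))
      ≡⟨ cong (λ u → A i p * (- s) + u) (ℤΣ.∑-*ˡ a (λ j → A i (punchIn p j) * y j)) ⟩
    A i p * (- s) + a * sumℤ (λ j → A i (punchIn p j) * y j) ∎

-- A relation between x and the columns of B, read through G, expresses x in terms of these columns.
leftInverse⇒rightInverse : ∀ {r} (G B : Matrix r r) → (∀ i k → (G ⊗ B) i k ≡ idMat i k) →
  ∀ (x : Fin r → ℤ) i → sumℤ (λ k → B i k * sumℤ (λ m → G k m * x m)) ≡ x i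
leftInverse⇒rightInverse {r} G B GB≡1 x i with kernel-vector r A
  where
  A : Matrix r (suc r)
  A i zero    = x i
  A i (suc k) = B i k
... | y , nonzero , h = ℤP.*-cancelˡ-≡ y₀ _ _ ⦃ ℤ.≢-nonZero (λ e → proj₂ nonzero (y₀≡0⇒y≡0 e (proj₁ nonzero))) ⦄ (begin
    y₀ * sumℤ (λ k → B i k * z k)          ≡⟨ sym (ℤΣ.∑-*ˡ y₀ (λ k → B i k * z k)) ⟩
    sumℤ (λ k → y₀ * (B i k * z k))        ≡⟨ ℤΣ.∑-cong (λ k → trans (move y₀ (B i k) (z k)) (cong (λ u → -[1+ 0 ] * (B i k * u)) (sym (y≡ k)))) ⟩
    sumℤ (λ k → -[1+ 0 ] * (B i k * y (suc k))) ≡⟨ ℤΣ.∑-*ˡ -[1+ 0 ] (λ k → B i k * y (suc k)) ⟩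
    -[1+ 0 ] * sumℤ (λ k → B i k * y (suc k))   ≡⟨ isolate (x i * y₀) (sumℤ (λ k → B i k * y (suc k))) (h i) ⟩
    x i * y₀                               ≡⟨ ℤP.*-comm (x i) y₀ ⟩
    y₀ * x i                               ∎)
  where
  open ≡-Reasoning
  y₀ : ℤ
  y₀ = y zero
  z : Fin r → ℤ
  z k = sumℤ (λ m → G k m * x m)
  move : ∀ a b c → a * (b * c) ≡ -[1+ 0 ] * (b * (- (a * c)))
  move = solve-∀
  isolate : ∀ a b → a + b ≡ + 0 → -[1+ 0 ] * b ≡ a
  isolate a b e = trans (ring a b) (trans (cong (λ u → a - u) e) (ℤP.+-identityʳ a))
    where
    ring : ∀ a b → -[1+ 0 ] * b ≡ a - (a + b)
    ring = solve-∀
  isolate′ : ∀ a b → a + b ≡ + 0 → b ≡ - a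
  isolate′ a b e = trans (ring a b) (trans (cong (λ u → u - a) e) (ℤP.+-identityˡ (- a)))
    where
    ring : ∀ a b → b ≡ (a + b) - a
    ring = solve-∀
  y≡ : ∀ k → y (suc k) ≡ - (y₀ * z k)
  y≡ k = isolate′ (y₀ * z k) (y (suc k)) (begin
    y₀ * z k + y (suc k)
      ≡⟨ cong₂ _+_ (ℤP.*-comm y₀ (z k)) (sym (∑-idMat k (y ∘ suc))) ⟩
    z k * y₀ + sumℤ (λ l → idMat k l * y (suc l))
      ≡⟨ cong (λ u → z k * y₀ + u) (ℤΣ.∑-cong (λ l → cong (_* y (suc l)) (sym (GB≡1 k l)))) ⟩
    z k * y₀ + sumℤ (λ l → (G ⊗ B) k l * y (suc l))
      ≡⟨ cong₂ _+_ (sym (ℤΣ.∑-*ʳ y₀ (λ m → G k m * x m))) (sym (ℤΣ.∑-assoc (G k) B (y ∘ suc))) ⟩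
    sumℤ (λ m → G k m * x m * y₀) + sumℤ (λ m → G k m * sumℤ (λ l → B m l * y (suc l)))
      ≡⟨ sym (ℤΣ.∑-+ (λ m → G k m * x m * y₀) (λ m → G k m * sumℤ (λ l → B m l * y (suc l)))) ⟩
    sumℤ (λ m → G k m * x m * y₀ + G k m * sumℤ (λ l → B m l * y (suc l)))
      ≡⟨ ℤΣ.∑-≡0 (λ m → trans (factor (G k m) (x m) y₀ (sumℤ (λ l → B m l * y (suc l))))
                       (trans (cong (G k m *_) (h m)) (ℤP.*-zeroʳ (G k m)))) ⟩
    + 0 ∎)
    where
    factor : ∀ g x y s → g * x * y + g * s ≡ g * (x * y + s)
    factor = solve-∀
  -- A left inverse makes the columns of `B` independent, so a nontrivial relation must involve `x`;
  -- this justifies cancelling `y₀`.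
  y₀≡0⇒y≡0 : y₀ ≡ + 0 → ∀ k → y k ≡ + 0
  y₀≡0⇒y≡0 e zero    = e
  y₀≡0⇒y≡0 e (suc k) = trans (y≡ k) (cong (λ u → - (u * z k)) e)

Unit : ℤ → Set
Unit z = (z ≡ + 1) ⊎ (z ≡ -[1+ 0 ])

Trit∧≢0⇒Unit : ∀ {z} → Trit z → z ≢ + 0 → Unit z
Trit∧≢0⇒Unit (inj₁ e) z≢0 = contradiction e z≢0
Trit∧≢0⇒Unit (inj₂ u) _   = u

Unit-square : ∀ {z} → Unit z → z * z ≡ + 1
Unit-square (inj₁ refl) = refl
Unit-square (inj₂ refl) = refl

Unit-*-Trit : ∀ {u z} → Unit u → Trit z → Trit (u * z)
Unit-*-Trit {z = z} (inj₁ refl) t = subst Trit (sym (ℤP.*-identityˡ z)) t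
Unit-*-Trit {z = z} (inj₂ refl) t = Trit-neg (subst Trit (flip z) t)
  where
  flip : ∀ z → z ≡ - (-[1+ 0 ] * z)
  flip = solve-∀

-- `G` inverts the submatrix of basis columns, and `G ⊗ M` is the tableau whose column `l` holds the
-- coordinates of column `l` of `M`. `basis` and `expansion` are the two one-sided inverse laws;
-- `exchange` says that every nonzero tableau entry is an admissible pivot.
record Coordinates {r n} (M : Matrix r n) (b : Fin r → Fin n) : Set where
  field
    G         : Matrix r r
    basis     : ∀ i k → (G ⊗ M) i (b k) ≡ idMat i k
    expansion : ∀ (x : Fin r → ℤ) i → sumℤ (λ k → M i (b k) * sumℤ (λ m → G k m * x m)) ≡ x i
    trit      : ∀ i l → Trit ((G ⊗ M) i l)
    exchange  : ∀ p l → (G ⊗ M) p l ≢ + 0 → Unit (maxMinor M (updateAt b p (const l)))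

-- Cramer's rule: the i-th coordinate is the minor with the i-th basis column replaced.
coordinates : ∀ {r n} (M : Matrix r n) → FullRankWeaklyUnimodular M → ∀ b → Unit (maxMinor M b) → Coordinates M b
coordinates {r} {n} M wu b unit = record
  { G         = G
  ; basis     = basis
  ; expansion = leftInverse⇒rightInverse G (λ i k → M i (b k)) basis
  ; trit      = λ i l → subst Trit (sym (cramer i l)) (Unit-*-Trit unit (allMinors-Trit M wu _))
  ; exchange  = λ p l ≢0 → Trit∧≢0⇒Unit (allMinors-Trit M wu _)
      (λ e → ≢0 (trans (cramer p l) (trans (cong (δ *_) e) (ℤP.*-zeroʳ δ))))
  }
  where
  open ≡-Reasoning
  δ : ℤ
  δ = maxMinor M b
  cofactors : (i : Fin r) → Σ (Fin r → ℤ) _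
  cofactors i = det-linear (λ a k → M a (b k)) i
  G : Matrix r r
  -- A unit of ℤ is its own inverse, so this factor performs the division by the basis minor.
  G i m = δ * proj₁ (cofactors i) m
  cramer : ∀ i l → (G ⊗ M) i l ≡ δ * maxMinor M (updateAt b i (const l))
  cramer i l = begin
    sumℤ (λ m → δ * g m * M m l)          ≡⟨ ℤΣ.∑-cong (λ m → ℤP.*-assoc δ (g m) (M m l)) ⟩
    sumℤ (λ m → δ * (g m * M m l))        ≡⟨ ℤΣ.∑-*ˡ δ (λ m → g m * M m l) ⟩
    δ * sumℤ (λ m → g m * M m l)          ≡⟨ cong (δ *_) (ℤΣ.∑-cong (λ m → cong (λ k → g m * M m k) (sym (updateAt-updates i b)))) ⟩
    δ * sumℤ (λ m → g m * M m (b′ i))     ≡⟨ cong (δ *_) (sym (proj₂ (cofactors i) (λ a k → M a (b′ k))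
                                               (λ a k k≢i → cong (M a) (updateAt-minimal k i b k≢i)))) ⟩
    δ * maxMinor M b′                     ∎
    where
    g = proj₁ (cofactors i)
    b′ = updateAt b i (const l)
  basis : ∀ i k → (G ⊗ M) i (b k) ≡ idMat i k
  basis i k with i ≟ k
  ... | yes refl = trans (cramer i (b i)) (trans (cong (δ *_) (maxMinor-cong M same)) (Unit-square unit))
    where
    same : ∀ j → updateAt b i (const (b i)) j ≡ b j
    same j with j ≟ i
    ... | yes refl = updateAt-updates i b
    ... | no j≢i   = updateAt-minimal j i b j≢i
  ... | no i≢k = trans (cramer i (b k)) (trans
        (cong (δ *_) (det-equalColumns _ i k i≢k
          (λ a → cong (M a) (trans (updateAt-updates i b) (sym (updateAt-minimal k i b (i≢k ∘ sym)))))))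
        (ℤP.*-zeroʳ δ))

-- A nonzero column has a nonzero coordinate in the basis supplied by full rank, and it can be
-- exchanged into the basis there.
∃-basis-through : ∀ {r n} (M : Matrix r n) → FullRankWeaklyUnimodular M → IrredundantColumns M →
  ∀ j → Σ (Fin r → Fin n) λ b → Σ (Fin r) λ p → (b p ≡ j) × Unit (maxMinor M b)
∃-basis-through M wu@((b , increasing , ≢0) , minors) (nonzeroColumn , _) j =
  extend (coordinates M wu b (Trit∧≢0⇒Unit (minors b increasing) ≢0))
  where
  extend : Coordinates M b → _
  extend C with all? (λ p → (Coordinates.G C ⊗ M) p j ℤP.≟ + 0)
  ... | yes GM≡0 = contradiction
          (λ i → trans (sym (Coordinates.expansion C (λ m → M m j) i))
                   (ℤΣ.∑-≡0 (λ k → trans (cong (M i (b k) *_) (GM≡0 k)) (ℤP.*-zeroʳ (M i (b k))))))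
          (nonzeroColumn j)
  ... | no ¬0 with ¬∀⟶∃¬ _ _ (λ p → (Coordinates.G C ⊗ M) p j ℤP.≟ + 0) ¬0
  ...   | p , p≢0 = updateAt b p (const j) , p , updateAt-updates p b , Coordinates.exchange C p j p≢0

-- Exposing functionals

∑-ones : ∀ r → sumℤ {r} (λ _ → + 1) ≡ + r
∑-ones zero    = refl
∑-ones (suc r) = cong (λ z → + 1 + z) (∑-ones r)

Unit-cancel : ∀ {u z} → Unit u → u * z ≡ + 0 → z ≡ + 0
Unit-cancel {z = z} (inj₁ refl) e = trans (sym (ℤP.*-identityˡ z)) e
Unit-cancel {z = z} (inj₂ refl) e = ℤP.neg-injective (trans (sym (ℤP.-1*i≡-i z)) e)

Trit-≥-1 : ∀ {z} → Trit z → -[1+ 0 ] ℤ.≤ z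
Trit-≥-1 (inj₁ refl)        = -≤+
Trit-≥-1 (inj₂ (inj₁ refl)) = -≤+
Trit-≥-1 (inj₂ (inj₂ refl)) = ℤP.≤-refl

0<i-j⇒j<i : ∀ {i j} → + 0 ℤ.< i - j → j ℤ.< i
0<i-j⇒j<i {i} {j} lt = subst₂ ℤ._<_ (ℤP.+-identityʳ j) (ring i j) (ℤP.+-monoʳ-< j lt)
  where
  ring : ∀ i j → j + (i - j) ≡ i
  ring = solve-∀

+-cancelʳ-< : ∀ k i j → i + k ℤ.< j + k → i ℤ.< j
+-cancelʳ-< k i j lt = subst₂ ℤ._<_ (ring k i) (ring k j) (ℤP.+-monoˡ-< (- k) lt)
  where
  ring : ∀ k i → i + k + - k ≡ i
  ring = solve-∀

-- Each of the other `r - 1` coordinates contributes at most 1, so `r` is the least integer weight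
-- with which position `p` outweighs them all.
weights : ∀ {r} → Fin r → (Fin r → ℤ) → Fin r → ℤ
weights {r} p t i with i ≟ p
... | yes _ = + r
... | no _  = - t i

weights-at : ∀ {r} (p : Fin r) t → weights p t p ≡ + r
weights-at p t with p ≟ p
... | yes _  = refl
... | no p≢p = contradiction refl p≢p

weights-off : ∀ {r} (p : Fin r) t {i} → i ≢ p → weights p t i ≡ - t i
weights-off p t {i} i≢p with i ≟ p
... | yes e = contradiction e i≢p
... | no _  = refl

-- The `p`-th unit vector has value `r`. If `z p` is 1, every other coordinate can only lower the
-- value, and it does so unless it vanishes. If `z p` is 0 or -1, the loss of at least `r` at `p`
-- exceeds any gain elsewhere.
weights-maximum : ∀ {r} (p : Fin r) (t z : Fin r → ℤ) → (∀ i → Unit (t i)) → (∀ i → Trit (z i)) →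
  (z p ≡ + 1 → ∀ i → i ≢ p → + 0 ℤ.≤ t i * z i) →
  (∀ i → z i ≡ idMat i p) ⊎ (sumℤ (λ i → weights p t i * z i) ℤ.< + r)
weights-maximum {r} p t z t-unit z-trit same-sign = byCases (z-trit p)
  where
  w y : Fin r → ℤ
  w = weights p t
  -- The shortfall of `z` against the unit vector, coordinate by coordinate; `z` lies strictly below
  -- the maximum once the total is positive.
  y i = w i * (idMat i p - z i)

  split : ∀ a b c → a * (b - c) ≡ a * b + -[1+ 0 ] * (a * c)
  split = solve-∀
  ∑y : sumℤ y ≡ + r - sumℤ (λ i → w i * z i)
  ∑y = begin
    sumℤ y
      ≡⟨ ℤΣ.∑-cong (λ i → split (w i) (idMat i p) (z i)) ⟩
    sumℤ (λ i → w i * idMat i p + -[1+ 0 ] * (w i * z i))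
      ≡⟨ ℤΣ.∑-+ (λ i → w i * idMat i p) (λ i → -[1+ 0 ] * (w i * z i)) ⟩
    sumℤ (λ i → w i * idMat i p) + sumℤ (λ i → -[1+ 0 ] * (w i * z i))
      ≡⟨ cong₂ _+_
           (ℤΣ.∑-single p (λ i → w i * idMat i p) (λ i i≢p → trans (cong (w i *_) (idMat-off i≢p)) (ℤP.*-zeroʳ (w i))))
           (ℤΣ.∑-*ˡ -[1+ 0 ] (λ i → w i * z i)) ⟩
    w p * idMat p p + -[1+ 0 ] * sumℤ (λ i → w i * z i)
      ≡⟨ cong₂ _+_ (trans (cong₂ _*_ (weights-at p t) (idMat-diag p)) (ℤP.*-identityʳ (+ r))) (ℤP.-1*i≡-i (sumℤ (λ i → w i * z i))) ⟩
    + r - sumℤ (λ i → w i * z i) ∎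
    where open ≡-Reasoning

  below : + 0 ℤ.< sumℤ y → sumℤ (λ i → w i * z i) ℤ.< + r
  below 0<∑y = 0<i-j⇒j<i (subst (+ 0 ℤ.<_) ∑y 0<∑y)

  y-off : ∀ {i} → i ≢ p → y i ≡ t i * z i
  y-off {i} i≢p = trans (cong₂ (λ a b → a * (b - z i)) (weights-off p t i≢p) (idMat-off i≢p)) (ring (t i) (z i))
    where
    ring : ∀ t z → (- t) * (+ 0 - z) ≡ t * z
    ring = solve-∀

  y-at : ∀ {ζ} → z p ≡ ζ → y p ≡ + r * (+ 1 - ζ)
  y-at e = cong₂ _*_ (weights-at p t) (cong₂ _-_ (idMat-diag p) e)

  tight : z p ≡ + 1 → _
  tight zp≡1 = dichotomy (sumℤ y ℤP.≟ + 0)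
    where
    y≥0 : ∀ i → + 0 ℤ.≤ y i
    y≥0 i = case i ≟ p of λ where
      (yes refl) → ℤP.≤-reflexive (sym (trans (y-at zp≡1) (ℤP.*-zeroʳ (+ r))))
      (no i≢p)   → subst (+ 0 ℤ.≤_) (sym (y-off i≢p)) (same-sign zp≡1 i i≢p)
    dichotomy : _ → _
    dichotomy (no ∑y≢0)  = inj₂ (below (ℤP.≤∧≢⇒< (ℤΣ.∑-nonneg y≥0) (∑y≢0 ∘ sym)))
    dichotomy (yes ∑y≡0) = inj₁ λ i → z≡id i (i ≟ p)
      where
      z≡id : ∀ i → _ → z i ≡ idMat i p
      z≡id i (yes refl) = trans zp≡1 (sym (idMat-diag p))
      z≡id i (no i≢p)   =
        trans (Unit-cancel (t-unit i) (trans (sym (y-off i≢p)) (ℤΣ.∑-nonneg-≡0 y≥0 ∑y≡0 i))) (sym (idMat-off i≢p))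

  -- Adding 1 to each of the `r` shortfalls makes all of them nonnegative, while the one at `p`
  -- alone then exceeds `r`; removing the added `r` leaves a positive total.
  loose : ∀ {ζ} → + 1 ℤ.≤ + 1 - ζ → z p ≡ ζ → sumℤ (λ i → w i * z i) ℤ.< + r
  loose {ζ} 1≤1-ζ zp≡ζ = below (+-cancelʳ-< (+ r) (+ 0) (sumℤ y) (begin-strict
    + 0 + + r                     ≡⟨ ℤP.+-identityˡ (+ r) ⟩
    + r                           ≡⟨ sym (ℤP.*-identityʳ (+ r)) ⟩
    + r * + 1                     ≤⟨ ℤP.*-monoˡ-≤-nonNeg (+ r) 1≤1-ζ ⟩
    + r * (+ 1 - ζ)               ≡⟨ sym (y-at zp≡ζ) ⟩
    y p                           <⟨ subst (ℤ._< y p + + 1) (ℤP.+-identityʳ (y p)) (ℤP.+-monoʳ-< (y p) (+<+ (ℕ.s≤s ℕ.z≤n))) ⟩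
    y p + + 1                     ≤⟨ ℤΣ.term≤∑ y+1≥0 p ⟩
    sumℤ (λ i → y i + + 1)        ≡⟨ ℤΣ.∑-+ y (λ _ → + 1) ⟩
    sumℤ y + sumℤ {r} (λ _ → + 1) ≡⟨ cong (λ s → sumℤ y + s) (∑-ones r) ⟩
    sumℤ y + + r                  ∎))
    where
    open ℤP.≤-Reasoning
    y+1≥0 : ∀ i → + 0 ℤ.≤ y i + + 1
    y+1≥0 i = case i ≟ p of λ where
      (yes refl) → ℤP.+-mono-≤ {+ 0} {y p} (subst (+ 0 ℤ.≤_) (sym (y-at zp≡ζ))
            (subst (ℤ._≤ + r * (+ 1 - ζ)) (ℤP.*-zeroʳ (+ r)) (ℤP.*-monoˡ-≤-nonNeg (+ r) (ℤP.≤-trans (+≤+ ℕ.z≤n) 1≤1-ζ))))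
            (+≤+ {0} ℕ.z≤n)
      (no i≢p)   → ℤP.+-mono-≤ (subst (-[1+ 0 ] ℤ.≤_) (sym (y-off i≢p)) (Trit-≥-1 (Unit-*-Trit (t-unit i) (z-trit i)))) (ℤP.≤-refl {+ 1})

  byCases : Trit (z p) → _
  byCases (inj₁ e)        = inj₂ (loose ℤP.≤-refl e)
  byCases (inj₂ (inj₁ e)) = tight e
  byCases (inj₂ (inj₂ e)) = inj₂ (loose (+≤+ (ℕ.s≤s ℕ.z≤n)) e)

-- Pivoting and sign patterns of the tableau

Trit-* : ∀ {a b} → Trit a → Trit b → Trit (a * b)
Trit-* (inj₁ refl)  _ = inj₁ refl
Trit-* (inj₂ unit)  t = Unit-*-Trit unit t

column-expansion : ∀ {r n} {M : Matrix r n} {b} (C : Coordinates M b) → ∀ l m →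
  sumℤ (λ k → M m (b k) * (Coordinates.G C ⊗ M) k l) ≡ M m l
column-expansion {M = M} C l m = Coordinates.expansion C (λ m → M m l) m

-- Expand column `l` in the old basis and apply row `i` of the new inverse. All old basis columns
-- except the one at `p` are still basis columns, so only that one adds a correction to the old row
-- `i`, with its new coordinate as the multiplier.
pivot : ∀ {r n} {M : Matrix r n} {b p l₀} (C : Coordinates M b) (C′ : Coordinates M (updateAt b p (const l₀))) →
  ∀ i → i ≢ p → ∀ l →
  (Coordinates.G C′ ⊗ M) i l ≡
    (Coordinates.G C ⊗ M) i l + (Coordinates.G C′ ⊗ M) i (b p) * (Coordinates.G C ⊗ M) p l
pivot {M = M} {b} {p} {l₀} C C′ i i≢p l = begin
  (G′ ⊗ M) i l
    ≡⟨ ℤΣ.∑-cong (λ m → cong (G′ i m *_) (sym (column-expansion C l m))) ⟩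
  sumℤ (λ m → G′ i m * sumℤ (λ k → M m (b k) * f k))
    ≡⟨ ℤΣ.∑-assoc (G′ i) (λ m k → M m (b k)) f ⟩
  sumℤ (λ k → (G′ ⊗ M) i (b k) * f k)
    ≡⟨ ℤΣ.∑-cong (λ k → trans (cong (_* f k) (row k)) (expand (idMat i k) β (idMat p k) (f k))) ⟩
  sumℤ (λ k → idMat i k * f k + β * (idMat p k * f k))
    ≡⟨ ℤΣ.∑-+ (λ k → idMat i k * f k) (λ k → β * (idMat p k * f k)) ⟩
  sumℤ (λ k → idMat i k * f k) + sumℤ (λ k → β * (idMat p k * f k))
    ≡⟨ cong₂ _+_ (∑-idMat i f) (trans (ℤΣ.∑-*ˡ β (λ k → idMat p k * f k)) (cong (β *_) (∑-idMat p f))) ⟩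
  f i + β * f p ∎
  where
  open ≡-Reasoning
  open Coordinates C using (G)
  open Coordinates C′ using () renaming (G to G′; basis to basis′)
  f = λ k → (G ⊗ M) k l
  β = (G′ ⊗ M) i (b p)
  expand : ∀ a b c x → (a + b * c) * x ≡ a * x + b * (c * x)
  expand = solve-∀
  row : ∀ k → (G′ ⊗ M) i (b k) ≡ idMat i k + β * idMat p k
  row k with k ≟ p
  ... | yes refl = sym (trans (cong₂ (λ a c → a + β * c) (idMat-off i≢p) (idMat-diag p))
                     (trans (ℤP.+-identityˡ (β * + 1)) (ℤP.*-identityʳ β)))
  ... | no k≢p   = trans (cong ((G′ ⊗ M) i) (sym (updateAt-minimal k p b k≢p))) (trans (basis′ i k)
                     (sym (trans (cong (λ c → idMat i k + β * c) (idMat-off (k≢p ∘ sym)))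
                            (trans (cong (λ c → idMat i k + c) (ℤP.*-zeroʳ β)) (ℤP.+-identityʳ (idMat i k))))))

-- Otherwise columns l and l′ would yield, after pivoting on l, a coordinate ±2.
no-opposite-signs : ∀ {r n} (M : Matrix r n) (wu : FullRankWeaklyUnimodular M) {b} (C : Coordinates M b) →
  let f = Coordinates.G C ⊗ M in
  ∀ p i → i ≢ p → ∀ l l′ → f p l * f i l ≡ -[1+ 0 ] → f p l′ * f i l′ ≢ + 1
no-opposite-signs M wu {b} C p i i≢p l l′ neg pos =
  absurd (trit p l′) (trit i l′) pos (subst Trit f′≡ (Coordinates.trit C′ i l′))
  where
  open Coordinates C
  f = G ⊗ M
  fpl≢0 : f p l ≢ + 0
  fpl≢0 e with trans (sym neg) (cong (_* f i l) e)
  ... | ()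
  C′ : Coordinates M (updateAt b p (const l))
  C′ = coordinates M wu _ (exchange p l fpl≢0)
  β : ℤ
  β = (Coordinates.G C′ ⊗ M) i (b p)
  -- Column `l` is the `p`-th vector of the new basis, so its `i`-th coordinate there is 0; this
  -- equation determines `β`.
  zero-at-l : f i l + β * f p l ≡ + 0
  zero-at-l = trans (sym (pivot C C′ i i≢p l))
    (trans (cong ((Coordinates.G C′ ⊗ M) i) (sym (updateAt-updates p b)))
      (trans (Coordinates.basis C′ i p) (idMat-off i≢p)))
  solveβ : ∀ {s x} → Unit s → s * x ≡ -[1+ 0 ] → ∀ β → x + β * s ≡ + 0 → β ≡ + 1
  solveβ {s} {x} u e β h = begin
    β                                    ≡⟨ sym (ℤP.*-identityʳ β) ⟩
    β * + 1                              ≡⟨ cong (β *_) (sym (Unit-square u)) ⟩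
    β * (s * s)                          ≡⟨ ring β s x ⟩
    s * (x + β * s) - s * x              ≡⟨ cong₂ (λ a c → s * a - c) h e ⟩
    s * + 0 + + 1                        ≡⟨ cong (_+ + 1) (ℤP.*-zeroʳ s) ⟩
    + 1                                  ∎
    where
    open ≡-Reasoning
    ring : ∀ β s x → β * (s * s) ≡ s * (x + β * s) - s * x
    ring = solve-∀
  f′≡ : (Coordinates.G C′ ⊗ M) i l′ ≡ f i l′ + f p l′
  f′≡ = trans (pivot C C′ i i≢p l′) (cong (λ c → f i l′ + c)
    (trans (cong (_* f p l′) (solveβ (Trit∧≢0⇒Unit (trit p l) fpl≢0) neg β zero-at-l)) (ℤP.*-identityˡ (f p l′))))
  absurd : ∀ {a c} → Trit a → Trit c → a * c ≡ + 1 → ¬ Trit (c + a)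
  absurd (inj₁ refl)        _                  ()
  absurd (inj₂ (inj₁ refl)) (inj₁ refl)        ()
  absurd (inj₂ (inj₁ refl)) (inj₂ (inj₁ refl)) _ = λ { (inj₁ ()) ; (inj₂ (inj₁ ())) ; (inj₂ (inj₂ ())) }
  absurd (inj₂ (inj₁ refl)) (inj₂ (inj₂ refl)) ()
  absurd (inj₂ (inj₂ refl)) (inj₁ refl)        ()
  absurd (inj₂ (inj₂ refl)) (inj₂ (inj₁ refl)) ()
  absurd (inj₂ (inj₂ refl)) (inj₂ (inj₂ refl)) _ = λ { (inj₁ ()) ; (inj₂ (inj₁ ())) ; (inj₂ (inj₂ ())) }

-- The product of two coordinates does not change when a column is negated, so a single sign serves
-- a column and its negative. Since the products never take both values 1 and -1, searching for a -1
-- decides `t`.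
common-sign : ∀ {r n} (M : Matrix r n) (wu : FullRankWeaklyUnimodular M) {b} (C : Coordinates M b) →
  let f = Coordinates.G C ⊗ M in
  ∀ p i → ∃ λ t → Unit t × (i ≢ p → ∀ l → + 0 ℤ.≤ t * (f p l * f i l))
common-sign M wu C p i with any? (λ l → (Coordinates.G C ⊗ M) p l * (Coordinates.G C ⊗ M) i l ℤP.≟ -[1+ 0 ])
... | yes (l , neg) = -[1+ 0 ] , inj₂ refl , λ i≢p l′ →
        nonpos (Trit-* (Coordinates.trit C p l′) (Coordinates.trit C i l′)) (no-opposite-signs M wu C p i i≢p l l′ neg)
  where
  nonpos : ∀ {z} → Trit z → z ≢ + 1 → + 0 ℤ.≤ -[1+ 0 ] * z
  nonpos (inj₁ refl)        _   = +≤+ ℕ.z≤n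
  nonpos (inj₂ (inj₁ e))    ≢1  = contradiction e ≢1
  nonpos (inj₂ (inj₂ refl)) _   = +≤+ ℕ.z≤n
... | no ¬neg = + 1 , inj₁ refl , λ i≢p l →
        nonneg (Trit-* (Coordinates.trit C p l) (Coordinates.trit C i l)) (λ e → ¬neg (l , e))
  where
  nonneg : ∀ {z} → Trit z → z ≢ -[1+ 0 ] → + 0 ℤ.≤ + 1 * z
  nonneg (inj₁ refl)        _   = +≤+ ℕ.z≤n
  nonneg (inj₂ (inj₁ refl)) _   = +≤+ ℕ.z≤n
  nonneg (inj₂ (inj₂ e))    ≢-1 = contradiction e ≢-1

-- Stated on the integral generators instead of the polytope. The first alternative compares
-- vectors, not indices, so a signed column that coincides with column `j` needs no separate
-- treatment.
ExposedBy : ∀ {r n} → Matrix r n → Fin n → (Fin r → ℤ) → ℤ → Set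
ExposedBy M j φ K = (sumℤ (λ m → φ m * M m j) ≡ K) ×
  (∀ ε → Unit ε → ∀ l → (∀ m → ε * M m l ≡ M m j) ⊎ (sumℤ (λ m → φ m * (ε * M m l)) ℤ.< K))

-- The functional is `weights` in the coordinates of a basis through column `j`, pulled back along
-- `G`. A signed column whose coordinates form the `p`-th unit vector is the basis column itself by
-- `expansion`.
columns-exposed : ∀ {r n} (M : Matrix r n) → FullRankWeaklyUnimodular M → IrredundantColumns M →
  ∀ j → ∃ λ φ → ∃ λ K → ExposedBy M j φ K
columns-exposed {r} {n} M wu ic j with ∃-basis-through M wu ic j
... | b , p , refl , unit = φ , + r , attained , bounded
  where
  open ≡-Reasoning
  C : Coordinates M b
  C = coordinates M wu b unit
  open Coordinates C
  t w φ : Fin r → ℤ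
  t i = proj₁ (common-sign M wu C p i)
  w = weights p t
  φ m = sumℤ (λ i → w i * G i m)

  attained : sumℤ (λ m → φ m * M m (b p)) ≡ + r
  attained = begin
    sumℤ (λ m → φ m * M m (b p))            ≡⟨ sym (ℤΣ.∑-assoc w G (λ m → M m (b p))) ⟩
    sumℤ (λ i → w i * (G ⊗ M) i (b p))      ≡⟨ ℤΣ.∑-cong (λ i → cong (w i *_) (basis i p)) ⟩
    sumℤ (λ i → w i * idMat i p)            ≡⟨ ℤΣ.∑-single p (λ i → w i * idMat i p)
                                                 (λ i i≢p → trans (cong (w i *_) (idMat-off i≢p)) (ℤP.*-zeroʳ (w i))) ⟩
    w p * idMat p p                         ≡⟨ trans (cong₂ _*_ (weights-at p t) (idMat-diag p)) (ℤP.*-identityʳ (+ r)) ⟩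
    + r                                     ∎

  bounded : ∀ ε → Unit ε → ∀ l → (∀ m → ε * M m l ≡ M m (b p)) ⊎ (sumℤ (λ m → φ m * (ε * M m l)) ℤ.< + r)
  bounded ε ε-unit l with weights-maximum p t z (λ i → proj₁ (proj₂ (common-sign M wu C p i)))
                            (λ i → subst Trit (sym (z≡ i)) (Unit-*-Trit ε-unit (trit i l))) same-sign
    where
    z : Fin r → ℤ
    z i = sumℤ (λ m → G i m * (ε * M m l))
    rearrange : ∀ g e m → g * (e * m) ≡ e * (g * m)
    rearrange = solve-∀
    z≡ : ∀ i → z i ≡ ε * (G ⊗ M) i l
    z≡ i = trans (ℤΣ.∑-cong (λ m → rearrange (G i m) ε (M m l))) (ℤΣ.∑-*ˡ ε (λ m → G i m * M m l))
    square : ∀ e a c → (e * e) * (a * c) ≡ (e * a) * (e * c)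
    square = solve-∀
    -- The factor `ε * ε = + 1` transfers the sign condition from column `l` to the signed column,
    -- and with `z p = + 1` the product reduces to `z i`.
    same-sign : z p ≡ + 1 → ∀ i → i ≢ p → + 0 ℤ.≤ t i * z i
    same-sign zp≡1 i i≢p = subst (λ x → + 0 ℤ.≤ t i * x) (begin
      (G ⊗ M) p l * (G ⊗ M) i l                  ≡⟨ sym (ℤP.*-identityˡ ((G ⊗ M) p l * (G ⊗ M) i l)) ⟩
      + 1 * ((G ⊗ M) p l * (G ⊗ M) i l)          ≡⟨ cong (_* ((G ⊗ M) p l * (G ⊗ M) i l)) (sym (Unit-square ε-unit)) ⟩
      (ε * ε) * ((G ⊗ M) p l * (G ⊗ M) i l)      ≡⟨ square ε ((G ⊗ M) p l) ((G ⊗ M) i l) ⟩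
      (ε * (G ⊗ M) p l) * (ε * (G ⊗ M) i l)      ≡⟨ sym (cong₂ _*_ (z≡ p) (z≡ i)) ⟩
      z p * z i                                  ≡⟨ cong (_* z i) zp≡1 ⟩
      + 1 * z i                                  ≡⟨ ℤP.*-identityˡ (z i) ⟩
      z i                                        ∎) (proj₂ (proj₂ (common-sign M wu C p i)) i≢p l)
  ... | inj₂ less = inj₂ (subst (ℤ._< + r) (ℤΣ.∑-assoc w G (λ m → ε * M m l)) less)
  ... | inj₁ z≡id = inj₁ λ m → begin
    ε * M m l
      ≡⟨ sym (expansion (λ m → ε * M m l) m) ⟩
    sumℤ (λ k → M m (b k) * sumℤ (λ m → G k m * (ε * M m l)))
      ≡⟨ ℤΣ.∑-cong (λ k → cong (M m (b k) *_) (z≡id k)) ⟩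
    sumℤ (λ k → M m (b k) * idMat k p)
      ≡⟨ ℤΣ.∑-single p (λ k → M m (b k) * idMat k p)
           (λ k k≢p → trans (cong (M m (b k) *_) (idMat-off k≢p)) (ℤP.*-zeroʳ (M m (b k)))) ⟩
    M m (b p) * idMat p p
      ≡⟨ trans (cong (M m (b p) *_) (idMat-diag p)) (ℤP.*-identityʳ (M m (b p))) ⟩
    M m (b p) ∎

-- Rational points of 𝒫

ι : ℤ → ℚ
ι z = z ℚ./ 1

-- Division in ℚ normalises and is stuck on a variable numerator, so the laws of `ι` are checked on
-- unnormalised fractions; the `0` is the denominator minus one.
toℚᵘ-ι : ∀ z → ℚ.toℚᵘ (ι z) ℚᵘ.≃ ℚᵘ.mkℚᵘ z 0
toℚᵘ-ι z = ℚP.toℚᵘ-fromℚᵘ (ℚᵘ.mkℚᵘ z 0)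

ι-+ : ∀ a b → ι (a ℤ.+ b) ≡ ι a ℚ.+ ι b
ι-+ a b = ℚP.toℚᵘ-injective (begin
  ℚ.toℚᵘ (ι (a ℤ.+ b))                     ≈⟨ toℚᵘ-ι (a ℤ.+ b) ⟩
  ℚᵘ.mkℚᵘ (a ℤ.+ b) 0                      ≈⟨ ℚᵘ.*≡* (cong (ℤ._* + 1) (sym (cong₂ ℤ._+_ (ℤP.*-identityʳ a) (ℤP.*-identityʳ b)))) ⟩
  ℚᵘ.mkℚᵘ a 0 ℚᵘ.+ ℚᵘ.mkℚᵘ b 0             ≈⟨ ℚᵘP.+-cong (toℚᵘ-ι a) (toℚᵘ-ι b) ⟨
  ℚ.toℚᵘ (ι a) ℚᵘ.+ ℚ.toℚᵘ (ι b)           ≈⟨ ℚP.toℚᵘ-homo-+ (ι a) (ι b) ⟨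
  ℚ.toℚᵘ (ι a ℚ.+ ι b)                     ∎)
  where open ℚᵘP.≃-Reasoning

ι-* : ∀ a b → ι (a ℤ.* b) ≡ ι a ℚ.* ι b
ι-* a b = ℚP.toℚᵘ-injective (begin
  ℚ.toℚᵘ (ι (a ℤ.* b))                     ≈⟨ toℚᵘ-ι (a ℤ.* b) ⟩
  ℚᵘ.mkℚᵘ a 0 ℚᵘ.* ℚᵘ.mkℚᵘ b 0             ≈⟨ ℚᵘP.*-cong (toℚᵘ-ι a) (toℚᵘ-ι b) ⟨
  ℚ.toℚᵘ (ι a) ℚᵘ.* ℚ.toℚᵘ (ι b)           ≈⟨ ℚP.toℚᵘ-homo-* (ι a) (ι b) ⟨
  ℚ.toℚᵘ (ι a ℚ.* ι b)                     ∎)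
  where open ℚᵘP.≃-Reasoning

ι-neg : ∀ a → ι (ℤ.- a) ≡ ℚ.- ι a
ι-neg a = ℚP.toℚᵘ-injective (begin
  ℚ.toℚᵘ (ι (ℤ.- a))          ≈⟨ toℚᵘ-ι (ℤ.- a) ⟩
  ℚᵘ.- ℚᵘ.mkℚᵘ a 0            ≈⟨ ℚᵘP.-‿cong (toℚᵘ-ι a) ⟨
  ℚᵘ.- ℚ.toℚᵘ (ι a)           ≈⟨ ℚP.toℚᵘ-homo‿- (ι a) ⟨
  ℚ.toℚᵘ (ℚ.- ι a)            ∎)
  where open ℚᵘP.≃-Reasoning

ι-injective : ∀ {a b} → ι a ≡ ι b → a ≡ b
ι-injective {a} {b} e = begin
  a            ≡⟨ ℤP.*-identityʳ a ⟨
  a ℤ.* + 1    ≡⟨ ℚᵘP.drop-*≡* (ℚP.fromℚᵘ-injective {ℚᵘ.mkℚᵘ a 0} {ℚᵘ.mkℚᵘ b 0} e) ⟩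
  b ℤ.* + 1    ≡⟨ ℤP.*-identityʳ b ⟩
  b            ∎
  where open ≡-Reasoning

ι-mono-< : ∀ {a b} → a ℤ.< b → ι a ℚ.< ι b
ι-mono-< {a} {b} a<b = ℚP.toℚᵘ-cancel-<
  (ℚᵘP.<-respˡ-≃ (ℚᵘP.≃-sym (toℚᵘ-ι a)) (ℚᵘP.<-respʳ-≃ (ℚᵘP.≃-sym (toℚᵘ-ι b))
    (ℚᵘ.*<* (subst₂ ℤ._<_ (sym (ℤP.*-identityʳ a)) (sym (ℤP.*-identityʳ b)) a<b))))

ι-∑ : ∀ {n} (f : Fin n → ℤ) → ι (sumℤ f) ≡ sumℚ (ι ∘ f)
ι-∑ {zero}  f = refl
ι-∑ {suc n} f = trans (ι-+ (f zero) (sumℤ (f ∘ suc))) (cong (λ s → ι (f zero) ℚ.+ s) (ι-∑ (f ∘ suc)))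

ι-dot : ∀ {n} (a x : Fin n → ℤ) → sumℚ (λ k → ι (a k) ℚ.* ι (x k)) ≡ ι (sumℤ (λ k → a k ℤ.* x k))
ι-dot a x = trans (ℚΣ.∑-cong (λ k → sym (ι-* (a k) (x k)))) (sym (ι-∑ (λ k → a k ℤ.* x k)))

p-q≡0⇒p≡q : ∀ {p q} → p ℚ.- q ≡ 0ℚ → p ≡ q
p-q≡0⇒p≡q {p} {q} e = trans (ring p q) (trans (cong (ℚ._+ q) e) (ℚP.+-identityˡ q))
  where
  ring : ∀ p q → p ≡ (p ℚ.- q) ℚ.+ q
  ring = solve 2 (λ p q → p := (p :- q) :+ q) refl
    where open +-*-Solver

p≤q⇒0≤q-p : ∀ {p q} → p ℚ.≤ q → 0ℚ ℚ.≤ q ℚ.- p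
p≤q⇒0≤q-p {p} {q} p≤q = subst (ℚ._≤ q ℚ.- p) (ℚP.+-inverseʳ p) (ℚP.+-monoˡ-≤ (ℚ.- p) p≤q)

0≤q-p⇒p≤q : ∀ {p q} → 0ℚ ℚ.≤ q ℚ.- p → p ℚ.≤ q
0≤q-p⇒p≤q {p} {q} h = subst₂ ℚ._≤_ (ℚP.+-identityˡ p) (ring p q) (ℚP.+-monoˡ-≤ p h)
  where
  ring : ∀ p q → (q ℚ.- p) ℚ.+ p ≡ q
  ring = solve 2 (λ p q → (q :- p) :+ p := q) refl
    where open +-*-Solver

p*q≡0⇒p≡0∨q≡0 : ∀ {p q} → p ℚ.* q ≡ 0ℚ → (p ≡ 0ℚ) ⊎ (q ≡ 0ℚ)
p*q≡0⇒p≡0∨q≡0 {p} {q} e with p ℚP.≟ 0ℚ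
... | yes p≡0 = inj₁ p≡0
... | no p≢0  = inj₂ (begin
    q                          ≡⟨ ℚP.*-identityˡ q ⟨
    1ℚ ℚ.* q                   ≡⟨ cong (ℚ._* q) (ℚP.*-inverseˡ p) ⟨
    (ℚ.1/ p) ℚ.* p ℚ.* q       ≡⟨ ℚP.*-assoc (ℚ.1/ p) p q ⟩
    (ℚ.1/ p) ℚ.* (p ℚ.* q)     ≡⟨ cong ((ℚ.1/ p) ℚ.*_) e ⟩
    (ℚ.1/ p) ℚ.* 0ℚ            ≡⟨ ℚP.*-zeroʳ (ℚ.1/ p) ⟩
    0ℚ                         ∎)
  where
  open ≡-Reasoning
  instance
    _ : ℚ.NonZero p
    _ = ℚ.≢-nonZero p≢0

*-nonneg : ∀ {p q} → 0ℚ ℚ.≤ p → 0ℚ ℚ.≤ q → 0ℚ ℚ.≤ p ℚ.* q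
*-nonneg {p} {q} 0≤p 0≤q = subst (ℚ._≤ p ℚ.* q) (ℚP.*-zeroʳ p) (ℚP.*-monoˡ-≤-nonNeg p ⦃ ℚ.nonNegative 0≤p ⦄ 0≤q)

-- Convex combinations and central symmetry

-- The gap between `K` and the average is the weighted sum of the gaps `K - v a`, all nonnegative.
-- It vanishes only if every term does, which forces `v a` to equal `K` wherever the weight is
-- nonzero.
module Average {k} (λs v : Fin k → ℚ) (K : ℚ)
  (λs≥0 : ∀ a → 0ℚ ℚ.≤ λs a) (∑λs≡1 : sumℚ λs ≡ 1ℚ) (v≤K : ∀ a → v a ℚ.≤ K) where

  gap : sumℚ (λ a → λs a ℚ.* (K ℚ.- v a)) ≡ K ℚ.- sumℚ (λ a → λs a ℚ.* v a)
  gap = begin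
    sumℚ (λ a → λs a ℚ.* (K ℚ.- v a))
      ≡⟨ ℚΣ.∑-cong (λ a → expand (λs a) K (v a)) ⟩
    sumℚ (λ a → λs a ℚ.* K ℚ.+ ℚ.- 1ℚ ℚ.* (λs a ℚ.* v a))
      ≡⟨ ℚΣ.∑-+ (λ a → λs a ℚ.* K) (λ a → ℚ.- 1ℚ ℚ.* (λs a ℚ.* v a)) ⟩
    sumℚ (λ a → λs a ℚ.* K) ℚ.+ sumℚ (λ a → ℚ.- 1ℚ ℚ.* (λs a ℚ.* v a))
      ≡⟨ cong₂ ℚ._+_ (trans (ℚΣ.∑-*ʳ K λs) (trans (cong (ℚ._* K) ∑λs≡1) (ℚP.*-identityˡ K)))
                     (trans (ℚΣ.∑-*ˡ (ℚ.- 1ℚ) (λ a → λs a ℚ.* v a)) (neg (sumℚ (λ a → λs a ℚ.* v a)))) ⟩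
    K ℚ.- sumℚ (λ a → λs a ℚ.* v a) ∎
    where
    open ≡-Reasoning
    open +-*-Solver
    expand : ∀ l K v → l ℚ.* (K ℚ.- v) ≡ l ℚ.* K ℚ.+ ℚ.- 1ℚ ℚ.* (l ℚ.* v)
    expand = solve 3 (λ l K v → l :* (K :- v) := l :* K :+ (:- con 1ℚ) :* (l :* v)) refl
    neg : ∀ x → ℚ.- 1ℚ ℚ.* x ≡ ℚ.- x
    neg = solve 1 (λ x → (:- con 1ℚ) :* x := :- x) refl

  terms≥0 : ∀ a → 0ℚ ℚ.≤ λs a ℚ.* (K ℚ.- v a)
  terms≥0 a = *-nonneg (λs≥0 a) (p≤q⇒0≤q-p (v≤K a))

  average-≤ : sumℚ (λ a → λs a ℚ.* v a) ℚ.≤ K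
  average-≤ = 0≤q-p⇒p≤q (subst (0ℚ ℚ.≤_) gap (ℚΣ.∑-nonneg terms≥0))

  average-≡ : sumℚ (λ a → λs a ℚ.* v a) ≡ K → ∀ a → (λs a ≡ 0ℚ) ⊎ (v a ≡ K)
  average-≡ e a with p*q≡0⇒p≡0∨q≡0 (ℚΣ.∑-nonneg-≡0 terms≥0 (trans gap (trans (cong (λ s → K ℚ.- s) e) (ℚP.+-inverseʳ K))) a)
  ... | inj₁ λ≡0   = inj₁ λ≡0
  ... | inj₂ K-v≡0 = inj₂ (sym (p-q≡0⇒p≡q K-v≡0))

∑-combination : ∀ {r k} (c : Fin r → ℚ) (λs : Fin k → ℚ) (g : Fin k → Point r) →
  sumℚ (λ m → c m ℚ.* sumℚ (λ a → λs a ℚ.* g a m)) ≡ sumℚ (λ a → λs a ℚ.* sumℚ (λ m → c m ℚ.* g a m))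
∑-combination c λs g = begin
  sumℚ (λ m → c m ℚ.* sumℚ (λ a → λs a ℚ.* g a m))
    ≡⟨ ℚΣ.∑-cong (λ m → cong (c m ℚ.*_) (ℚΣ.∑-cong (λ a → ℚP.*-comm (λs a) (g a m)))) ⟩
  sumℚ (λ m → c m ℚ.* sumℚ (λ a → g a m ℚ.* λs a))
    ≡⟨ ℚΣ.∑-assoc c (λ m a → g a m) λs ⟩
  sumℚ (λ a → sumℚ (λ m → c m ℚ.* g a m) ℚ.* λs a)
    ≡⟨ ℚΣ.∑-cong (λ a → ℚP.*-comm (sumℚ (λ m → c m ℚ.* g a m)) (λs a)) ⟩
  sumℚ (λ a → λs a ℚ.* sumℚ (λ m → c m ℚ.* g a m)) ∎
  where open ≡-Reasoning

-- Brings the generators into the form of a sign times a column, over which `ExposedBy` quantifies.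
signed-column : ∀ {n} (a : Fin (n ℕ.+ n)) →
  ∃ λ ε → ∃ λ l → Unit ε × (∀ {r} (M : Matrix r n) i → columnsPM M a i ≡ ι (ε ℤ.* M i l))
signed-column {n} a with splitAt n a
... | inj₁ l = + 1 , l , inj₁ refl , λ M i → cong ι (sym (ℤP.*-identityˡ (M i l)))
... | inj₂ l = -[1+ 0 ] , l , inj₂ refl , λ M i → cong ι (sym (ℤP.-1*i≡-i (M i l)))

columnsPM-↑ˡ : ∀ {r n} (M : Matrix r n) j i → columnsPM M (j ↑ˡ n) i ≡ ι (M i j)
columnsPM-↑ˡ {n = n} M j i rewrite splitAt-↑ˡ n j n = refl

columnsPM-↑ʳ : ∀ {r n} (M : Matrix r n) j i → columnsPM M (n ↑ʳ j) i ≡ ι (ℤ.- M i j)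
columnsPM-↑ʳ {n = n} M j i rewrite splitAt-↑ʳ n n j = refl

InConvexHull-resp : ∀ {r k} {g : Fin k → Point r} {x y} → (∀ i → y i ≡ x i) → InConvexHull g x → InConvexHull g y
InConvexHull-resp e (λs , nonneg , total , h) = λs , nonneg , total , λ i → trans (e i) (h i)

generator∈InConvexHull : ∀ {r k} (g : Fin k → Point r) a → InConvexHull g (g a)
generator∈InConvexHull g a = (λ b → ι (idMat a b)) , nonneg ,
  trans (ℚΣ.∑-single a (λ b → ι (idMat a b)) (λ b b≢a → cong ι (idMat-off (b≢a ∘ sym)))) (cong ι (idMat-diag a)) ,
  λ i → sym (trans
    (ℚΣ.∑-single a (λ b → ι (idMat a b) ℚ.* g b i)
      (λ b b≢a → trans (cong (λ e → ι e ℚ.* g b i) (idMat-off (b≢a ∘ sym))) (ℚP.*-zeroˡ (g b i))))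
    (trans (cong (λ e → ι e ℚ.* g a i) (idMat-diag a)) (ℚP.*-identityˡ (g a i))))
  where
  nonneg : ∀ b → 0ℚ ℚ.≤ ι (idMat a b)
  nonneg b with a ≟ b
  ... | yes _ = ℚP.nonNegative⁻¹ 1ℚ
  ... | no _  = ℚP.≤-refl

column∈𝒫 : ∀ {r n} (M : Matrix r n) j → 𝒫 M (λ i → ι (M i j))
column∈𝒫 {n = n} M j =
  InConvexHull-resp (λ i → sym (columnsPM-↑ˡ M j i)) (generator∈InConvexHull (columnsPM M) (j ↑ˡ n))

∑-↑ : ∀ m {n} (f : Fin (m ℕ.+ n) → ℚ) → sumℚ f ≡ sumℚ (λ i → f (i ↑ˡ n)) ℚ.+ sumℚ (λ i → f (m ↑ʳ i))
∑-↑ zero    f = sym (ℚP.+-identityˡ (sumℚ f))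
∑-↑ (suc m) {n} f = trans (cong (λ s → f zero ℚ.+ s) (∑-↑ m (f ∘ suc)))
  (sym (ℚP.+-assoc (f zero) (sumℚ (λ i → f (suc (i ↑ˡ n)))) (sumℚ (λ i → f (suc (m ↑ʳ i))))))

-- Interchanging the two halves of the index set negates every generator, so the weights of `x`,
-- carried through this interchange, represent `- x`.
𝒫-neg : ∀ {r n} (M : Matrix r n) {x} → 𝒫 M x → 𝒫 M (λ i → ℚ.- x i)
𝒫-neg {r} {n} M {x} (λs , nonneg , total , h) = λs ∘ opposite , (λ a → nonneg (opposite a)) ,
  trans (∑-opposite λs) total , λ i → begin
    ℚ.- x i                                                     ≡⟨ cong ℚ.-_ (h i) ⟩
    ℚ.- sumℚ (λ a → λs a ℚ.* columnsPM M a i)                   ≡⟨ neg (sumℚ (λ a → λs a ℚ.* columnsPM M a i)) ⟩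
    ℚ.- 1ℚ ℚ.* sumℚ (λ a → λs a ℚ.* columnsPM M a i)            ≡⟨ ℚΣ.∑-*ˡ (ℚ.- 1ℚ) (λ a → λs a ℚ.* columnsPM M a i) ⟨
    sumℚ (λ a → ℚ.- 1ℚ ℚ.* (λs a ℚ.* columnsPM M a i))          ≡⟨ ∑-opposite (λ a → ℚ.- 1ℚ ℚ.* (λs a ℚ.* columnsPM M a i)) ⟨
    sumℚ (λ a → ℚ.- 1ℚ ℚ.* (λs (opposite a) ℚ.* columnsPM M (opposite a) i))
      ≡⟨ ℚΣ.∑-cong (λ a → trans (cong (λ c → ℚ.- 1ℚ ℚ.* (λs (opposite a) ℚ.* c)) (columnsPM-opposite a i))
                                (cancel (λs (opposite a)) (columnsPM M a i))) ⟩
    sumℚ (λ a → λs (opposite a) ℚ.* columnsPM M a i)            ∎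
  where
  open ≡-Reasoning
  open +-*-Solver
  opposite : Fin (n ℕ.+ n) → Fin (n ℕ.+ n)
  opposite a = join n n (swap (splitAt n a))
  opposite-↑ˡ : ∀ j → opposite (j ↑ˡ n) ≡ n ↑ʳ j
  opposite-↑ˡ j = cong (join n n ∘ swap) (splitAt-↑ˡ n j n)
  opposite-↑ʳ : ∀ j → opposite (n ↑ʳ j) ≡ j ↑ˡ n
  opposite-↑ʳ j = cong (join n n ∘ swap) (splitAt-↑ʳ n n j)
  ∑-opposite : ∀ f → sumℚ (f ∘ opposite) ≡ sumℚ f
  ∑-opposite f = begin
    sumℚ (f ∘ opposite)
      ≡⟨ ∑-↑ n (f ∘ opposite) ⟩
    sumℚ (λ j → f (opposite (j ↑ˡ n))) ℚ.+ sumℚ (λ j → f (opposite (n ↑ʳ j)))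
      ≡⟨ cong₂ ℚ._+_ (ℚΣ.∑-cong (λ j → cong f (opposite-↑ˡ j))) (ℚΣ.∑-cong (λ j → cong f (opposite-↑ʳ j))) ⟩
    sumℚ (λ j → f (n ↑ʳ j)) ℚ.+ sumℚ (λ j → f (j ↑ˡ n))
      ≡⟨ ℚP.+-comm (sumℚ (λ j → f (n ↑ʳ j))) (sumℚ (λ j → f (j ↑ˡ n))) ⟩
    sumℚ (λ j → f (j ↑ˡ n)) ℚ.+ sumℚ (λ j → f (n ↑ʳ j))
      ≡⟨ ∑-↑ n f ⟨
    sumℚ f ∎
  columnsPM-opposite : ∀ a i → columnsPM M (opposite a) i ≡ ℚ.- columnsPM M a i
  columnsPM-opposite a i with splitAt n a
  ... | inj₁ j = trans (columnsPM-↑ʳ M j i) (ι-neg (M i j))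
  ... | inj₂ j = trans (columnsPM-↑ˡ M j i) (trans (cong ι (sym (ℤP.neg-involutive (M i j)))) (ι-neg (ℤ.- M i j)))
  neg : ∀ x → ℚ.- x ≡ ℚ.- 1ℚ ℚ.* x
  neg = solve 1 (λ x → :- x := (:- con 1ℚ) :* x) refl
  cancel : ∀ l c → ℚ.- 1ℚ ℚ.* (l ℚ.* (ℚ.- c)) ≡ l ℚ.* c
  cancel = solve 2 (λ l c → (:- con 1ℚ) :* (l :* (:- c)) := l :* c) refl

-- Exposed points of `𝒫`

-- Doubles as the action of a matrix: `F i ∙ x` is the `i`-th coordinate of `F x`, in exactly the
-- form used by `AffineImage`.
_∙_ : ∀ {r} → (Fin r → ℤ) → Point r → ℚ
φ ∙ x = sumℚ (λ m → ι (φ m) ℚ.* x m)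

module Exposed {r n} (M : Matrix r n) (j : Fin n) (φ : Fin r → ℤ) (K : ℤ) (exposed : ExposedBy M j φ K) where

  column-value : φ ∙ (λ i → ι (M i j)) ≡ ι K
  column-value = trans (ι-dot φ (λ i → M i j)) (cong ι (proj₁ exposed))

  generator-value : ∀ a → (∀ i → columnsPM M a i ≡ ι (M i j)) ⊎ (φ ∙ columnsPM M a ℚ.< ι K)
  generator-value a = value (signed-column a)
    where
    value : (∃ λ ε → ∃ λ l → Unit ε × (∀ {r} (M : Matrix r n) i → columnsPM M a i ≡ ι (ε ℤ.* M i l))) →
      (∀ i → columnsPM M a i ≡ ι (M i j)) ⊎ (φ ∙ columnsPM M a ℚ.< ι K)
    value (ε , l , unit , h) = Sum.map
      (λ same i → trans (h M i) (cong ι (same i)))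
      (λ less → subst (ℚ._< ι K)
        (sym (trans (ℚΣ.∑-cong (λ m → cong (ι (φ m) ℚ.*_) (h M m))) (ι-dot φ (λ m → ε ℤ.* M m l))))
        (ι-mono-< less))
      (proj₂ exposed ε unit l)

  generator-≤ : ∀ a → φ ∙ columnsPM M a ℚ.≤ ι K
  generator-≤ a = [ (λ same → ℚP.≤-reflexive (trans (ℚΣ.∑-cong (λ m → cong (ι (φ m) ℚ.*_) (same m))) column-value))
                  , ℚP.<⇒≤ ] (generator-value a)

  module _ {x} (x∈𝒫 : 𝒫 M x) where
    private
      λs : Fin (n ℕ.+ n) → ℚ
      λs = proj₁ x∈𝒫
      total : sumℚ λs ≡ 1ℚ
      total = proj₁ (proj₂ (proj₂ x∈𝒫))
      x≡ : ∀ i → x i ≡ sumℚ (λ a → λs a ℚ.* columnsPM M a i)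
      x≡ = proj₂ (proj₂ (proj₂ x∈𝒫))
      open Average λs (λ a → φ ∙ columnsPM M a) (ι K) (proj₁ (proj₂ x∈𝒫)) total generator-≤

      value : φ ∙ x ≡ sumℚ (λ a → λs a ℚ.* (φ ∙ columnsPM M a))
      value = trans (ℚΣ.∑-cong (λ m → cong (ι (φ m) ℚ.*_) (x≡ m))) (∑-combination (ι ∘ φ) λs (columnsPM M))

    exposed-≤ : φ ∙ x ℚ.≤ ι K
    exposed-≤ = subst (ℚ._≤ ι K) (sym value) average-≤

    -- At the maximum, each generator either has weight 0 or equals the exposed column as a point,
    -- so `x` is the total weight 1 times that column.
    exposed-≡ : φ ∙ x ≡ ι K → ∀ i → x i ≡ ι (M i j)
    exposed-≡ e i = begin
      x i                                        ≡⟨ x≡ i ⟩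
      sumℚ (λ a → λs a ℚ.* columnsPM M a i)      ≡⟨ ℚΣ.∑-cong (λ a → term a (generator-value a) (average-≡ (trans (sym value) e) a)) ⟩
      sumℚ (λ a → λs a ℚ.* ι (M i j))            ≡⟨ ℚΣ.∑-*ʳ (ι (M i j)) λs ⟩
      sumℚ λs ℚ.* ι (M i j)                      ≡⟨ cong (ℚ._* ι (M i j)) total ⟩
      1ℚ ℚ.* ι (M i j)                           ≡⟨ ℚP.*-identityˡ (ι (M i j)) ⟩
      ι (M i j)                                  ∎
      where
      open ≡-Reasoning
      term : ∀ a → (∀ i → columnsPM M a i ≡ ι (M i j)) ⊎ (φ ∙ columnsPM M a ℚ.< ι K) →
        (λs a ≡ 0ℚ) ⊎ (φ ∙ columnsPM M a ≡ ι K) → λs a ℚ.* columnsPM M a i ≡ λs a ℚ.* ι (M i j)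
      term a (inj₁ same) _            = cong (λs a ℚ.*_) (same i)
      term a (inj₂ less) (inj₂ equal) = contradiction equal (ℚP.<⇒≢ less)
      term a (inj₂ less) (inj₁ λ≡0)   = begin
        λs a ℚ.* columnsPM M a i  ≡⟨ cong (ℚ._* columnsPM M a i) λ≡0 ⟩
        0ℚ ℚ.* columnsPM M a i    ≡⟨ ℚP.*-zeroˡ (columnsPM M a i) ⟩
        0ℚ                        ≡⟨ ℚP.*-zeroˡ (ι (M i j)) ⟨
        0ℚ ℚ.* ι (M i j)          ≡⟨ cong (ℚ._* ι (M i j)) λ≡0 ⟨
        λs a ℚ.* ι (M i j)        ∎

∙-cong : ∀ {r} (φ : Fin r → ℤ) {x y : Point r} → (∀ m → x m ≡ y m) → φ ∙ x ≡ φ ∙ y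
∙-cong φ h = ℚΣ.∑-cong (λ m → cong (ι (φ m) ℚ.*_) (h m))

∙-+ : ∀ {r} (φ : Fin r → ℤ) (x y : Point r) → φ ∙ (λ m → x m ℚ.+ y m) ≡ φ ∙ x ℚ.+ φ ∙ y
∙-+ φ x y = trans (ℚΣ.∑-cong (λ m → ℚP.*-distribˡ-+ (ι (φ m)) (x m) (y m)))
  (ℚΣ.∑-+ (λ m → ι (φ m) ℚ.* x m) (λ m → ι (φ m) ℚ.* y m))

∙-neg : ∀ {r} (φ : Fin r → ℤ) (x : Point r) → φ ∙ (λ m → ℚ.- x m) ≡ ℚ.- (φ ∙ x)
∙-neg φ x = trans (ℚΣ.∑-cong (λ m → move (ι (φ m)) (x m)))
  (trans (ℚΣ.∑-*ˡ (ℚ.- 1ℚ) (λ m → ι (φ m) ℚ.* x m)) (neg (φ ∙ x)))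
  where
  open +-*-Solver
  move : ∀ a x → a ℚ.* (ℚ.- x) ≡ ℚ.- 1ℚ ℚ.* (a ℚ.* x)
  move = solve 2 (λ a x → a :* (:- x) := (:- con 1ℚ) :* (a :* x)) refl
  neg : ∀ x → ℚ.- 1ℚ ℚ.* x ≡ ℚ.- x
  neg = solve 1 (λ x → (:- con 1ℚ) :* x := :- x) refl

∙-inverse : ∀ {r} (G F : Matrix r r) → (∀ i j → (G ⊗ F) i j ≡ idMat i j) →
  ∀ (x : Point r) i → G i ∙ (λ k → F k ∙ x) ≡ x i
∙-inverse G F GF≡1 x i = begin
  G i ∙ (λ k → F k ∙ x)
    ≡⟨ ℚΣ.∑-assoc (λ k → ι (G i k)) (λ k m → ι (F k m)) x ⟩
  sumℚ (λ m → sumℚ (λ k → ι (G i k) ℚ.* ι (F k m)) ℚ.* x m)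
    ≡⟨ ℚΣ.∑-cong (λ m → cong (ℚ._* x m) (trans (ι-dot (G i) (λ k → F k m)) (cong ι (GF≡1 i m)))) ⟩
  sumℚ (λ m → ι (idMat i m) ℚ.* x m)
    ≡⟨ ℚΣ.∑-single i (λ m → ι (idMat i m) ℚ.* x m)
         (λ m m≢i → trans (cong (λ e → ι e ℚ.* x m) (idMat-off (m≢i ∘ sym))) (ℚP.*-zeroˡ (x m))) ⟩
  ι (idMat i i) ℚ.* x i
    ≡⟨ trans (cong (λ e → ι e ℚ.* x i) (idMat-diag i)) (ℚP.*-identityˡ (x i)) ⟩
  x i ∎
  where open ≡-Reasoning

-- Translating the exposed column `c` gives `φ ∙ u ≤ 0`. Translating `- c` and negating back puts
-- `c - u` into the polytope, which gives the reverse inequality. So `c + u` attains the maximum as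
-- well and must equal `c`.
exposed-no-translation : ∀ {r n} (M : Matrix r n) (j : Fin n) φ K → ExposedBy M j φ K → (u : Point r) →
  (∀ {y} → 𝒫 M y → 𝒫 M (λ i → y i ℚ.+ u i)) → ∀ i → u i ≡ 0ℚ
exposed-no-translation {r} M j φ K exposed u translate i = begin
  u i                                ≡⟨ ring (ι (M i j)) (u i) ⟩
  (ι (M i j) ℚ.+ u i) ℚ.- ι (M i j)  ≡⟨ cong (ℚ._- ι (M i j)) (exposed-≡ c+u∈𝒫 (trans c+u-value (trans (cong (λ d → ι K ℚ.+ d) φu≡0) (ℚP.+-identityʳ (ι K)))) i) ⟩
  ι (M i j) ℚ.- ι (M i j)            ≡⟨ ℚP.+-inverseʳ (ι (M i j)) ⟩
  0ℚ                                 ∎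
  where
  open ≡-Reasoning
  open +-*-Solver
  open Exposed M j φ K exposed
  ring : ∀ c u → u ≡ (c ℚ.+ u) ℚ.- c
  ring = solve 2 (λ c u → u := (c :+ u) :- c) refl
  cancel : ∀ K d → K ℚ.- (K ℚ.+ d) ≡ 0ℚ ℚ.- d
  cancel = solve 2 (λ K d → K :- (K :+ d) := con 0ℚ :- d) refl
  cancel′ : ∀ K d → K ℚ.- (ℚ.- (ℚ.- K ℚ.+ d)) ≡ d
  cancel′ = solve 2 (λ K d → K :- (:- (:- K :+ d)) := d) refl
  c : Point r
  c i = ι (M i j)
  c+u∈𝒫 : 𝒫 M (λ i → c i ℚ.+ u i)
  c+u∈𝒫 = translate (column∈𝒫 M j)
  c-u∈𝒫 : 𝒫 M (λ i → ℚ.- (ℚ.- c i ℚ.+ u i))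
  c-u∈𝒫 = 𝒫-neg M (translate (𝒫-neg M (column∈𝒫 M j)))
  c+u-value : φ ∙ (λ i → c i ℚ.+ u i) ≡ ι K ℚ.+ φ ∙ u
  c+u-value = trans (∙-+ φ c u) (cong (ℚ._+ φ ∙ u) column-value)
  c-u-value : φ ∙ (λ i → ℚ.- (ℚ.- c i ℚ.+ u i)) ≡ ℚ.- (ℚ.- ι K ℚ.+ φ ∙ u)
  c-u-value = trans (∙-neg φ (λ i → ℚ.- c i ℚ.+ u i)) (cong ℚ.-_
    (trans (∙-+ φ (λ i → ℚ.- c i) u) (cong (ℚ._+ φ ∙ u) (trans (∙-neg φ c) (cong ℚ.-_ column-value)))))
  φu≡0 : φ ∙ u ≡ 0ℚ
  φu≡0 = ℚP.≤-antisym
    (0≤q-p⇒p≤q (subst (0ℚ ℚ.≤_) (trans (cong (λ d → ι K ℚ.- d) c+u-value) (cancel (ι K) (φ ∙ u))) (p≤q⇒0≤q-p (exposed-≤ c+u∈𝒫))))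
    (subst (0ℚ ℚ.≤_) (trans (cong (λ d → ι K ℚ.- d) c-u-value) (cancel′ (ι K) (φ ∙ u))) (p≤q⇒0≤q-p (exposed-≤ c-u∈𝒫)))

-- Transport along the affine equivalence

module AffineEquivalence {r n} (M N : Matrix r n) (F G : Matrix r r) (v : Fin r → ℤ)
  (FG≡1 : ∀ i j → (F ⊗ G) i j ≡ idMat i j) (GF≡1 : ∀ i j → (G ⊗ F) i j ≡ idMat i j)
  (equivalence : ∀ x → 𝒫 N x ⇔ AffineImage F v (𝒫 M) x)
  (exposed : ∀ j → ∃ λ φ → ∃ λ K → ExposedBy M j φ K) where

  open ≡-Reasoning
  open +-*-Solver

  forward : ∀ {y} → 𝒫 M y → 𝒫 N (λ i → F i ∙ y ℚ.+ ι (v i))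
  forward {y} y∈𝒫 = Equivalence.from (equivalence (λ i → F i ∙ y ℚ.+ ι (v i))) (y , y∈𝒫 , λ i → refl)

  backward : ∀ {x} → 𝒫 N x → AffineImage F v (𝒫 M) x
  backward {x} = Equivalence.to (equivalence x)

  2v u : Point r
  2v i = ι (v i) ℚ.+ ι (v i)
  u i  = G i ∙ 2v

  -- Since both polytopes are centrally symmetric, conjugating x ↦ − x by the equivalence
  -- gives a second symmetry of 𝒫 M, and the two differ by this translation.
  translation : ∀ {y} → 𝒫 M y → 𝒫 M (λ i → y i ℚ.+ u i)
  translation {y} y∈𝒫 = reflect (backward (𝒫-neg N (forward y∈𝒫)))
    where
    isolate : ∀ b w → w ≡ (w ℚ.+ b) ℚ.- b
    isolate = solve 2 (λ b w → w := (w :+ b) :- b) refl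
    collect : ∀ a b → ℚ.- (a ℚ.+ b) ℚ.- b ≡ ℚ.- (a ℚ.+ (b ℚ.+ b))
    collect = solve 2 (λ a b → (:- (a :+ b)) :- b := :- (a :+ (b :+ b))) refl
    neg-neg : ∀ a → a ≡ ℚ.- (ℚ.- a)
    neg-neg = solve 1 (λ a → a := :- (:- a)) refl
    reflect : AffineImage F v (𝒫 M) (λ i → ℚ.- (F i ∙ y ℚ.+ ι (v i))) → 𝒫 M (λ i → y i ℚ.+ u i)
    reflect (y′ , y′∈𝒫 , h) = InConvexHull-resp (λ i → trans (neg-neg (y i ℚ.+ u i)) (cong ℚ.-_ (sym (y′≡ i)))) (𝒫-neg M y′∈𝒫)
      where
      Fy′≡ : ∀ k → F k ∙ y′ ≡ ℚ.- (F k ∙ y ℚ.+ 2v k)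
      Fy′≡ k = begin
        F k ∙ y′                                         ≡⟨ isolate (ι (v k)) (F k ∙ y′) ⟩
        (F k ∙ y′ ℚ.+ ι (v k)) ℚ.- ι (v k)               ≡⟨ cong (ℚ._- ι (v k)) (h k) ⟨
        ℚ.- (F k ∙ y ℚ.+ ι (v k)) ℚ.- ι (v k)            ≡⟨ collect (F k ∙ y) (ι (v k)) ⟩
        ℚ.- (F k ∙ y ℚ.+ 2v k)                           ∎
      y′≡ : ∀ i → y′ i ≡ ℚ.- (y i ℚ.+ u i)
      y′≡ i = begin
        y′ i                                             ≡⟨ ∙-inverse G F GF≡1 y′ i ⟨
        G i ∙ (λ k → F k ∙ y′)                           ≡⟨ ∙-cong (G i) Fy′≡ ⟩
        G i ∙ (λ k → ℚ.- (F k ∙ y ℚ.+ 2v k))             ≡⟨ ∙-neg (G i) (λ k → F k ∙ y ℚ.+ 2v k) ⟩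
        ℚ.- (G i ∙ (λ k → F k ∙ y ℚ.+ 2v k))             ≡⟨ cong ℚ.-_ (∙-+ (G i) (λ k → F k ∙ y) 2v) ⟩
        ℚ.- (G i ∙ (λ k → F k ∙ y) ℚ.+ u i)              ≡⟨ cong (λ a → ℚ.- (a ℚ.+ u i)) (∙-inverse G F GF≡1 y i) ⟩
        ℚ.- (y i ℚ.+ u i)                                ∎

  -- The column index supplies the exposed point. From `u = 0` follows `2v = F u = 0`, and ℤ has no
  -- 2-torsion.
  v≡0 : Fin n → ∀ i → v i ≡ + 0
  v≡0 j i = i≡-i⇒i≡0 (v i) (ℤ-cancel (v i) (ι-injective (begin
    ι (v i ℤ.+ v i)               ≡⟨ ι-+ (v i) (v i) ⟩
    2v i                          ≡⟨ ∙-inverse F G FG≡1 2v i ⟨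
    F i ∙ u                       ≡⟨ ∙-cong (F i) u≡0 ⟩
    F i ∙ (λ _ → 0ℚ)              ≡⟨ ℚΣ.∑-≡0 (λ m → ℚP.*-zeroʳ (ι (F i m))) ⟩
    ι (+ 0)                       ∎)))
    where
    u≡0 : ∀ k → u k ≡ 0ℚ
    u≡0 = exposed-no-translation M j (proj₁ (exposed j)) (proj₁ (proj₂ (exposed j))) (proj₂ (proj₂ (exposed j))) u translation
    ℤ-cancel : ∀ a → a ℤ.+ a ≡ + 0 → a ≡ ℤ.- a
    ℤ-cancel a e = trans (ring a) (trans (cong (ℤ._- a) e) (ℤP.+-identityˡ (ℤ.- a)))
      where
      ring : ∀ a → a ≡ (a ℤ.+ a) ℤ.- a
      ring = solve-∀

  -- The image of column `c` is a convex combination of the generators `d a` of `𝒫 N`. Their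
  -- preimages `G d a` lie in `𝒫 M` and average to `c`, where `φ` is maximal, so any generator of
  -- nonzero weight satisfies `G d a = c`, that is, `d a = F c`.
  column-image : ∀ j → ∃ λ ε → ∃ λ l → Unit ε × (∀ i → (F ⊗ M) i j ≡ ε ℤ.* N i l)
  column-image j = fromGenerator (¬∀⟶∃¬ (n ℕ.+ n) (λ a → λs a ≡ 0ℚ) (λ a → λs a ℚP.≟ 0ℚ) someWeight)
    where
    φ : Fin r → ℤ
    φ = proj₁ (exposed j)
    K : ℤ
    K = proj₁ (proj₂ (exposed j))
    open Exposed M j φ K (proj₂ (proj₂ (exposed j)))

    drop-v : ∀ {x y : Point r} → (∀ i → x i ≡ F i ∙ y ℚ.+ ι (v i)) → ∀ i → x i ≡ F i ∙ y
    drop-v {x} {y} h i = trans (h i) (trans (cong (λ a → F i ∙ y ℚ.+ ι a) (v≡0 j i)) (ℚP.+-identityʳ (F i ∙ y)))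

    preimage∈𝒫 : ∀ {x} → 𝒫 N x → 𝒫 M (λ i → G i ∙ x)
    preimage∈𝒫 {x} x∈𝒫 = pull (backward x∈𝒫)
      where
      pull : AffineImage F v (𝒫 M) x → 𝒫 M (λ i → G i ∙ x)
      pull (y , y∈𝒫 , h) =
        InConvexHull-resp (λ i → trans (∙-cong (G i) (drop-v {x} {y} h)) (∙-inverse G F GF≡1 y i)) y∈𝒫

    c q : Point r
    c i = ι (M i j)
    q i = F i ∙ c ℚ.+ ι (v i)
    d : Fin (n ℕ.+ n) → Point r
    d = columnsPM N
    q∈𝒫 : 𝒫 N q
    q∈𝒫 = forward (column∈𝒫 M j)
    λs : Fin (n ℕ.+ n) → ℚ
    λs = proj₁ q∈𝒫
    total : sumℚ λs ≡ 1ℚ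
    total = proj₁ (proj₂ (proj₂ q∈𝒫))

    d′∈𝒫 : ∀ a → 𝒫 M (λ i → G i ∙ d a)
    d′∈𝒫 a = preimage∈𝒫 (generator∈InConvexHull d a)

    open Average λs (λ a → φ ∙ (λ i → G i ∙ d a)) (ι K) (proj₁ (proj₂ q∈𝒫)) total (λ a → exposed-≤ (d′∈𝒫 a))

    value : sumℚ (λ a → λs a ℚ.* (φ ∙ (λ i → G i ∙ d a))) ≡ ι K
    value = begin
      sumℚ (λ a → λs a ℚ.* (φ ∙ (λ i → G i ∙ d a)))      ≡⟨ ∑-combination (ι ∘ φ) λs (λ a i → G i ∙ d a) ⟨
      φ ∙ (λ i → sumℚ (λ a → λs a ℚ.* (G i ∙ d a)))      ≡⟨ ∙-cong φ (λ i → ∑-combination (ι ∘ G i) λs d) ⟨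
      φ ∙ (λ i → G i ∙ (λ m → sumℚ (λ a → λs a ℚ.* d a m)))  ≡⟨ ∙-cong φ (λ i → ∙-cong (G i) (proj₂ (proj₂ (proj₂ q∈𝒫)))) ⟨
      φ ∙ (λ i → G i ∙ q)                                ≡⟨ ∙-cong φ (λ i → trans (∙-cong (G i) (drop-v {q} {c} (λ m → refl))) (∙-inverse G F GF≡1 c i)) ⟩
      φ ∙ c                                              ≡⟨ column-value ⟩
      ι K                                                ∎

    someWeight : ¬ (∀ a → λs a ≡ 0ℚ)
    someWeight all0 = 1≢0 (trans (sym total) (ℚΣ.∑-≡0 all0))
      where
      1≢0 : 1ℚ ≢ 0ℚ
      1≢0 ()

    fromGenerator : (∃ λ a → λs a ≢ 0ℚ) → ∃ λ ε → ∃ λ l → Unit ε × (∀ i → (F ⊗ M) i j ≡ ε ℤ.* N i l)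
    fromGenerator (a , λ≢0) = describe (signed-column a)
      where
      attained : (λs a ≡ 0ℚ) ⊎ (φ ∙ (λ i → G i ∙ d a) ≡ ι K) → φ ∙ (λ i → G i ∙ d a) ≡ ι K
      attained (inj₁ λ≡0) = contradiction λ≡0 λ≢0
      attained (inj₂ e)   = e
      d′≡c : ∀ i → G i ∙ d a ≡ c i
      d′≡c = exposed-≡ {λ i → G i ∙ d a} (d′∈𝒫 a) (attained (average-≡ value a))
      describe : (∃ λ ε → ∃ λ l → Unit ε × (∀ {r} (N : Matrix r n) i → columnsPM N a i ≡ ι (ε ℤ.* N i l))) →
        ∃ λ ε → ∃ λ l → Unit ε × (∀ i → (F ⊗ M) i j ≡ ε ℤ.* N i l)
      describe (ε , l , unit , h) = ε , l , unit , λ i → ι-injective {(F ⊗ M) i j} {ε ℤ.* N i l} (begin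
        ι ((F ⊗ M) i j)              ≡⟨ ι-dot (F i) (λ m → M m j) ⟨
        F i ∙ c                      ≡⟨ ∙-cong (F i) d′≡c ⟨
        F i ∙ (λ k → G k ∙ d a)      ≡⟨ ∙-inverse F G FG≡1 (d a) i ⟩
        d a i                        ≡⟨ h N i ⟩
        ι (ε ℤ.* N i l)              ∎)

-- The signed permutation

-- Pigeonhole: punching a missed value out of the codomain would inject `Fin (suc n)` into `Fin n`.
injective⇒surjective : ∀ {n} (f : Fin n → Fin n) → (∀ {i j} → f i ≡ f j → i ≡ j) → ∀ k → ∃ λ i → f i ≡ k
injective⇒surjective {suc n} f inj k with any? (λ i → f i ≟ k)
... | yes hit = hit
... | no miss = contradiction
        (injective⇒≤ {f = λ i → punchOut (k≢f i)} (λ {i} {j} e → inj (punchOut-injective (k≢f i) (k≢f j) e)))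
        ℕP.1+n≰n
  where
  k≢f : ∀ i → k ≢ f i
  k≢f i e = miss (i , sym e)

⊗-cancelˡ : ∀ {r} (F G : Matrix r r) → (∀ i j → (G ⊗ F) i j ≡ idMat i j) → (x y : Fin r → ℤ) →
  (∀ i → sumℤ (λ m → F i m ℤ.* x m) ≡ sumℤ (λ m → F i m ℤ.* y m)) → ∀ i → x i ≡ y i
⊗-cancelˡ F G GF≡1 x y h i = begin
  x i                                                    ≡⟨ recover x ⟨
  sumℤ (λ k → G i k ℤ.* sumℤ (λ m → F k m ℤ.* x m))      ≡⟨ ℤΣ.∑-cong (λ k → cong (G i k ℤ.*_) (h k)) ⟩
  sumℤ (λ k → G i k ℤ.* sumℤ (λ m → F k m ℤ.* y m))      ≡⟨ recover y ⟩
  y i                                                    ∎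
  where
  open ≡-Reasoning
  recover : ∀ z → sumℤ (λ k → G i k ℤ.* sumℤ (λ m → F k m ℤ.* z m)) ≡ z i
  recover z = trans (ℤΣ.∑-assoc (G i) F z) (trans (ℤΣ.∑-cong (λ m → cong (ℤ._* z m) (GF≡1 i m))) (∑-idMat i z))

signedPermutation : ∀ {n} (σ : Permutation′ n) (ε : Fin n → ℤ) → (∀ i → Unit (ε i)) → Σ (Matrix n n) SignedPermutationMatrix
signedPermutation {n} σ ε unit = P , P-signed
  where
  P : Matrix n n
  P i j with j ≟ (σ ⟨$⟩ʳ i)
  ... | yes _ = ε i
  ... | no _  = + 0
  -- The right-hand side is local to the definition of SignedPermutationMatrix;
  -- it is inferred from P-signed, which therefore comes first.
  agrees : ∀ i j → P i j ≡ _
  P-signed : SignedPermutationMatrix P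
  P-signed = σ , ε , unit , agrees
  agrees i j with j ≟ (σ ⟨$⟩ʳ i)
  ... | yes _ = refl
  ... | no _  = refl

-- The entry formula is reachable only through the type of `h`; abstracting the equality test
-- together with `h` makes it reduce.
signedPermutation-at : ∀ {n} {P : Matrix n n} ((σ , ε , _) : SignedPermutationMatrix P) → ∀ i → P i (σ ⟨$⟩ʳ i) ≡ ε i
signedPermutation-at (σ , ε , _ , h) i with (σ ⟨$⟩ʳ i) ≟ (σ ⟨$⟩ʳ i) | h i (σ ⟨$⟩ʳ i)
... | yes _ | e = e
... | no ≢  | _ = contradiction refl ≢

signedPermutation-off : ∀ {n} {P : Matrix n n} ((σ , ε , _) : SignedPermutationMatrix P) → ∀ i j → j ≢ σ ⟨$⟩ʳ i → P i j ≡ + 0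
signedPermutation-off (σ , ε , _ , h) i j j≢ with j ≟ (σ ⟨$⟩ʳ i) | h i j
... | yes e | _ = contradiction e j≢
... | no _  | e = e

theorem4p5 : (r n : ℕ) → 0 < r → r ≤ n → (M N : Matrix r n) →
    FullRankWeaklyUnimodular M → IrredundantColumns M →
    FullRankWeaklyUnimodular N → IrredundantColumns N →
    UnimodularlyEquivalent (𝒫 M) (𝒫 N) →
    Σ (Matrix r r) λ F → Σ (Matrix n n) λ P →
    InGL F × SignedPermutationMatrix P × (∀ i j → N i j ≡ ((F ⊗ M) ⊗ P) i j)
theorem4p5 r n 0<r r≤n M N wuM icM wuN icN (F , v , (G , FG≡1 , GF≡1) , equivalence) =
  F , P , (G , FG≡1 , GF≡1) , P-signed , N≡FMP
  where
  open AffineEquivalence M N F G v FG≡1 GF≡1 equivalence (columns-exposed M wuM icM)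
  open ≡-Reasoning

  ε : Fin n → ℤ
  ε j = proj₁ (column-image j)
  image : Fin n → Fin n
  image j = proj₁ (proj₂ (column-image j))
  unit : ∀ j → Unit (ε j)
  unit j = proj₁ (proj₂ (proj₂ (column-image j)))
  FM≡ : ∀ j i → (F ⊗ M) i j ≡ ε j ℤ.* N i (image j)
  FM≡ j = proj₂ (proj₂ (proj₂ (column-image j)))

  -- Columns with a common image become the same column of `N` up to sign under `F`; cancelling `F`
  -- leaves columns of `M` that agree up to sign, against irredundancy unless `j = k`.
  parallel : ∀ {j k} → image j ≡ image k → ∀ i → M i j ≡ (ε j ℤ.* ε k) ℤ.* M i k
  parallel {j} {k} e = ⊗-cancelˡ F G GF≡1 (λ m → M m j) (λ m → (ε j ℤ.* ε k) ℤ.* M m k) λ i → begin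
    (F ⊗ M) i j                                            ≡⟨ FM≡ j i ⟩
    ε j ℤ.* N i (image j)                                  ≡⟨ cong (λ l → ε j ℤ.* N i l) e ⟩
    ε j ℤ.* N i (image k)                                  ≡⟨ insert (unit k) (ε j) (N i (image k)) ⟩
    (ε j ℤ.* ε k) ℤ.* (ε k ℤ.* N i (image k))              ≡⟨ cong ((ε j ℤ.* ε k) ℤ.*_) (FM≡ k i) ⟨
    (ε j ℤ.* ε k) ℤ.* (F ⊗ M) i k                          ≡⟨ ℤΣ.∑-*ˡ (ε j ℤ.* ε k) (λ m → F i m ℤ.* M m k) ⟨
    sumℤ (λ m → (ε j ℤ.* ε k) ℤ.* (F i m ℤ.* M m k))       ≡⟨ ℤΣ.∑-cong (λ m → comm (ε j ℤ.* ε k) (F i m) (M m k)) ⟩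
    sumℤ (λ m → F i m ℤ.* ((ε j ℤ.* ε k) ℤ.* M m k))       ∎
    where
    insert : ∀ {e} → Unit e → ∀ a x → a ℤ.* x ≡ (a ℤ.* e) ℤ.* (e ℤ.* x)
    insert {e} u a x = trans (cong (a ℤ.*_) (trans (sym (ℤP.*-identityˡ x)) (cong (ℤ._* x) (sym (Unit-square u))))) (ring a e x)
      where
      ring : ∀ a e x → a ℤ.* (e ℤ.* e ℤ.* x) ≡ (a ℤ.* e) ℤ.* (e ℤ.* x)
      ring = solve-∀
    comm : ∀ a b c → a ℤ.* (b ℤ.* c) ≡ b ℤ.* (a ℤ.* c)
    comm = solve-∀

  Unit-* : ∀ {a b} → Unit a → Unit b → Unit (a ℤ.* b)
  Unit-* (inj₁ refl) (inj₁ refl) = inj₁ refl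
  Unit-* (inj₁ refl) (inj₂ refl) = inj₂ refl
  Unit-* (inj₂ refl) (inj₁ refl) = inj₂ refl
  Unit-* (inj₂ refl) (inj₂ refl) = inj₁ refl

  image-injective : ∀ {j k} → image j ≡ image k → j ≡ k
  image-injective {j} {k} e = case j ≟ k of λ where
    (yes j≡k) → j≡k
    (no j≢k)  → contradiction (Unit-* (unit j) (unit k)) [
      (λ η≡1  → proj₁ (proj₂ icM j k j≢k) (λ i → trans (parallel e i) (trans (cong (ℤ._* M i k) η≡1) (ℤP.*-identityˡ (M i k))))) ,
      (λ η≡-1 → proj₂ (proj₂ icM j k j≢k) (λ i → trans (parallel e i) (trans (cong (ℤ._* M i k) η≡-1) (ℤP.-1*i≡-i (M i k))))) ]

  preimage : ∀ k → ∃ λ j → image j ≡ k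
  preimage = injective⇒surjective image image-injective

  σ : Permutation′ n
  σ = permutation image (proj₁ ∘ preimage) (λ k → proj₂ (preimage k)) (λ j → image-injective (proj₂ (preimage (image j))))

  P : Matrix n n
  P = proj₁ (signedPermutation σ ε unit)
  P-signed : SignedPermutationMatrix P
  P-signed = proj₂ (signedPermutation σ ε unit)

  -- Column `k` of `P` has its only nonzero entry in the row `j₀` with `image j₀ = k`; the sign
  -- there meets the sign in `FM≡` and squares to 1.
  N≡FMP : ∀ i k → N i k ≡ ((F ⊗ M) ⊗ P) i k
  N≡FMP i k = sym (begin
    sumℤ (λ j → (F ⊗ M) i j ℤ.* P j k)
      ≡⟨ ℤΣ.∑-single j₀ (λ j → (F ⊗ M) i j ℤ.* P j k) (λ j j≢ → trans
           (cong ((F ⊗ M) i j ℤ.*_) (signedPermutation-off P-signed j k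
             (λ e → j≢ (image-injective (sym (trans (proj₂ (preimage k)) e))))))
           (ℤP.*-zeroʳ ((F ⊗ M) i j))) ⟩
    (F ⊗ M) i j₀ ℤ.* P j₀ k
      ≡⟨ cong₂ ℤ._*_ (FM≡ j₀ i) (trans (cong (P j₀) (sym (proj₂ (preimage k)))) (signedPermutation-at P-signed j₀)) ⟩
    (ε j₀ ℤ.* N i (image j₀)) ℤ.* ε j₀
      ≡⟨ ring (ε j₀) (N i (image j₀)) ⟩
    (ε j₀ ℤ.* ε j₀) ℤ.* N i (image j₀)
      ≡⟨ cong₂ ℤ._*_ (Unit-square (unit j₀)) (cong (N i) (proj₂ (preimage k))) ⟩
    + 1 ℤ.* N i k
      ≡⟨ ℤP.*-identityˡ (N i k) ⟩
    N i k ∎)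
    where
    j₀ : Fin n
    j₀ = proj₁ (preimage k)
    ring : ∀ e x → (e ℤ.* x) ℤ.* e ≡ (e ℤ.* e) ℤ.* x
    ring = solve-∀
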